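{- Let $n\ge1$, let $q_1,\ldots,q_n\ge 2$ be integers, let $t$ be an integer with $0\le t\le n$, and let $q$ be the harmonic mean of the $q_i$, i.e. $\frac1q=\frac1n\sum_{i=1}^n\frac1{q_i}$. If $C$ is an orthogonal array with parameters $\mathrm{OA}(N,q_1\cdot\ldots\cdot q_n,t)$, then $$N\ \ge\ q_1q_2\cdots q_n\Big(1-\big(1-\tfrac1q\big)\tfrac{n}{t+1}\Big).\qquad(\star)$$ Moreover, a multiset $C$ of vertices of the graph $H=H(q_1\cdot\ldots\cdot q_n)$ is an $\mathrm{OA}(|C|,q_1\cdot\ldots\cdot q_n,t)$ meeting $(\star)$ (with $N=|C|$) with equality if and only if $C$ is a simple set (no element has multiplicity more than $1$) and a $\{k;-\theta_{t+1}\}$-CR code in $H$, where $k=Qn(1-\frac1q)$ (the degree of $H$), $\theta_{t+1}=k-(t+1)Q$, and $Q=\mathrm{lcm}(q_1,\ldots,q_n)$.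
   Context: For a positive integer $s$, $[s]=\{0,\ldots,s-1\}$. Graphs are multigraphs, and numbers of edges (and degrees) are counted with multiplicity. Cardinalities of multisets count multiplicities. The graph $H(q_1\cdot\ldots\cdot q_n)$ has vertex set $V=[q_1]\times\cdots\times[q_n]$; two $n$-tuples are joined by an edge of multiplicity $Q/q_i$ if they differ in exactly one position, namely the $i$th, where $Q=\mathrm{lcm}(q_1,\ldots,q_n)$; all other pairs are non-adjacent. Orthogonal array: a nonempty multiset $C$ of elements of $V$ is an orthogonal array of strength $t$, denoted $\mathrm{OA}(|C|,q_1\cdot\ldots\cdot q_n,t)$, if for any distinct $i_1,\ldots,i_t\in\{1,\ldots,n\}$ and any $a_j\in[q_{i_j}]$, $j=1,\ldots,t$, the number (with multiplicity) of $(x_1,\ldots,x_n)\in C$ with $x_{i_j}=a_j$ for all $j=1,\ldots,t$ equals $|C|/(q_{i_1}\cdots q_{i_t})$. $\{b;c\}$-CR code (completely regular code with covering radius $1$ and intersection array $\{b;c\}$), where $b,c>0$: a set $C$ of vertices of a regular graph with vertex set $V$ such that every vertex in $C$ is connected with $V\setminus C$ by exactly $b$ edges and every vertex in $V\setminus C$ is connected with $C$ by exactly $c$ edges. (In particular, if $c\le 0$ there is no $\{b;c\}$-CR code.) -}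

module Defs where

open import Algebra.Properties.CommutativeMonoid.Sum using (sum)
open import Data.Bool.Base using (if_then_else_)
open import Data.Fin.Base using (Fin)
open import Data.Fin.Properties using (_≟_; all?; any?)
open import Data.Integer.Base using (+_)
open import Data.Nat.Base as ℕ using (ℕ; suc; _≤_; _<_; NonZero; >-nonZero)
open import Data.Nat.LCM using (lcm)
open import Data.Nat.Properties as ℕ using (_<?_)
open import Data.Product.Base using (_×_; _,_)
open import Data.Rational.Base as ℚ using (ℚ; 0ℚ)
open import Data.Rational.Properties as ℚ using ()
open import Data.Vec.Base using (Vec; []; _∷_; foldr′; lookup)
open import Data.Vec.Relation.Unary.All using (All; []; _∷_)
open import Data.Vec.Relation.Unary.All.Properties using (lookup⁺)
open import Function.Definitions using (Injective)
open import Relation.Binary.PropositionalEquality.Core using (_≡_; _≢_)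
open import Relation.Nullary.Decidable using (yes; no; does; ¬?; _×-dec_; _→-dec_)
open import Relation.Unary using (Pred; Decidable; ∁)
open import Relation.Unary.Properties using (∁?)
open import Level using (0ℓ)

∑ : ∀ {n} → (Fin n → ℕ) → ℕ
∑ = sum ℕ.+-0-commutativeMonoid

∏ : ∀ {n} → (Fin n → ℕ) → ℕ
∏ = sum ℕ.*-1-commutativeMonoid

∑ℚ : ∀ {n} → (Fin n → ℚ) → ℚ
∑ℚ = sum ℚ.+-0-commutativeMonoid

fromℕ : ℕ → ℚ
fromℕ m = + m ℚ./ 1

-- [q₁] × ⋯ × [qₙ] as heterogeneous tuples, so that _≡_ is equality of tuples.
Vertex : ∀ {n} → Vec ℕ n → Set
Vertex qs = All Fin qs

_at_ : ∀ {n} {qs : Vec ℕ n} → Vertex qs → (i : Fin n) → Fin (lookup qs i)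
_at_ = lookup⁺

∑V : ∀ {n} {qs : Vec ℕ n} → (Vertex qs → ℕ) → ℕ
∑V {qs = []}     f = f []
∑V {qs = q ∷ qs} f = ∑ λ a → ∑V λ x → f (a ∷ x)

-- A multiset is given by the multiplicity of each vertex.
Multiset : ∀ {n} → Vec ℕ n → Set
Multiset qs = Vertex qs → ℕ

lcms : ∀ {n} → Vec ℕ n → ℕ
lcms = foldr′ lcm 1

module _ {n} {qs : Vec ℕ n} where

  card : Multiset qs → ℕ
  card C = ∑V C

  count : {P : Pred (Vertex qs) 0ℓ} → Decidable P → Multiset qs → ℕ
  count P? C = ∑V λ x → if does (P? x) then C x else 0

  Simple : Multiset qs → Set
  Simple C = ∀ x → C x ≤ 1

  Support : Multiset qs → Pred (Vertex qs) 0ℓ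
  Support C x = 0 < C x

  Support? : (C : Multiset qs) → Decidable (Support C)
  Support? C x = 0 <? C x

  module _ {t} (i : Fin t → Fin n) (a : ∀ j → Fin (lookup qs (i j))) where

    Matches : Pred (Vertex qs) 0ℓ
    Matches x = ∀ j → x at i j ≡ a j

    Matches? : Decidable Matches
    Matches? x = all? λ j → x at i j ≟ a j

  record IsOA (N t : ℕ) (C : Multiset qs) : Set where
    field
      size     : card C ≡ N
      nonempty : 0 < card C
      -- The count equals |C| / (q_{i₁}⋯q_{iₜ}), with the denominator cleared.
      strength : (i : Fin t → Fin n) → Injective _≡_ _≡_ i →
                 (a : ∀ j → Fin (lookup qs (i j))) →
                 count (Matches? i a) C ℕ.* ∏ (λ j → lookup qs (i j)) ≡ card C

  module _ (x y : Vertex qs) where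

    DifferOnlyAt : Pred (Fin n) 0ℓ
    DifferOnlyAt i = x at i ≢ y at i × (∀ j → j ≢ i → x at j ≡ y at j)

    DifferOnlyAt? : Decidable DifferOnlyAt
    DifferOnlyAt? i =
      ¬? (x at i ≟ y at i) ×-dec all? λ j → ¬? (j ≟ i) →-dec (x at j ≟ y at j)

module _ {n} (qs : Vec ℕ n) (qs≥2 : ∀ i → 2 ≤ lookup qs i) where

  private instance
    lookup-nonZero : ∀ {i} → NonZero (lookup qs i)
    lookup-nonZero {i} = >-nonZero (ℕ.<⇒≤ (qs≥2 i))

  IsHarmonicMean : .{{NonZero n}} → (q : ℚ) → .{{ℚ.NonZero q}} → Set
  IsHarmonicMean q = ℚ.1/ q ≡ (+ 1 ℚ./ n) ℚ.* ∑ℚ (λ i → + 1 ℚ./ lookup qs i)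

  -- The multiplicity of the edge between x and y in H(q₁⋯qₙ), 0 if there is
  -- none; the division is exact.
  edges : Vertex qs → Vertex qs → ℕ
  edges x y with any? (DifferOnlyAt? x y)
  ... | yes (i , _) = lcms qs ℕ./ lookup qs i
  ... | no _        = 0

  edgesTo : {S : Pred (Vertex qs) 0ℓ} → Decidable S → Vertex qs → ℕ
  edgesTo S? x = ∑V λ y → if does (S? y) then edges x y else 0

  record IsCRCode (b c : ℚ) {S : Pred (Vertex qs) 0ℓ} (S? : Decidable S) : Set where
    field
      b>0     : b ℚ.> 0ℚ
      c>0     : c ℚ.> 0ℚ
      inside  : ∀ x → S x → fromℕ (edgesTo (∁? S?) x) ≡ b
      outside : ∀ x → ∁ S x → fromℕ (edgesTo S? x) ≡ c

{-# OPTIONS --safe #-}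
module Submission where

-- Identify C with its multiplicity function f on V = [q₁] × ⋯ × [qₙ].  Averaging over
-- single coordinates gives commuting projections E_i, hence orthogonal components P_S f
-- (S ⊆ {1,…,n}), and the adjacency operator of H is A = k − Q·L with L = Σ_i (I − E_i),
-- which acts on the S-component as |S|.  Being an orthogonal array of strength t means
-- P_S f = 0 for 1 ≤ |S| ≤ t.  Put r = L f − (t+1) f + (t+1) N/|V|; its S-component is
-- (|S| − (t+1)) P_S f for S ≠ ∅ and 0 for S = ∅, so ⟨f, r⟩ ≥ 0 by Parseval.  With
-- c = −θ_{t+1}, expanding ⟨f, r⟩ gives
--   (t+1) Q N²/|V| = c N + Q ⟨f, r⟩ + c ⟨f, f − 1⟩ + ⟨f, A f⟩,
-- and the bound follows because the last three terms are nonnegative (if c ≥ 0).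
-- Equality forces all three to vanish: r = 0 (constant number c of neighbours outside),
-- f is 0/1-valued, and no two codewords are adjacent.  Conversely a CR code satisfies
-- Q L f = (t+1) Q f − c, and applying P_S kills every component with 1 ≤ |S| ≤ t.

open import Defs
open import Algebra.Bundles using (CommutativeMonoid; CommutativeRing)
import Algebra.Properties.CommutativeMonoid.Sum as MonoidSum
import Algebra.Properties.Semiring.Sum as SemiringSum
open import Data.Bool.Base using (Bool; true; false; if_then_else_; not; _∧_)
open import Data.Fin.Base using (Fin; zero; suc; fromℕ<)
open import Data.Fin.Properties using (_≟_; any?; suc-injective; 0≢1+n)
open import Data.Fin.Subset using (Subset; inside; outside; ∣_∣; _⊆_; _⊈_; ⊥; _∈_)
open import Data.Fin.Subset.Properties using (drop-∷-⊆; out⊆; in⊆in; _⊆?_; p⊆q⇒∣p∣≤∣q∣; ⊥⊆; ∣⊥∣≡0)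
open import Data.Integer.Base as ℤ using (+_; +[1+_])
import Data.Integer.Properties as ℤ
open import Data.Nat.Base as ℕ using (ℕ; zero; suc; z≤n; s≤s; NonZero) renaming (_≤_ to _≤ℕ_)
import Data.Nat.Coprimality as Coprimality
open import Data.Nat.Divisibility using (_∣_; ∣-trans)
import Data.Nat.DivMod as ℕ
import Data.Nat.GCD as ℕ
import Data.Nat.LCM as ℕ
import Data.Nat.Properties as ℕ
open import Data.Product.Base using (∃; _×_; _,_; proj₁; proj₂)
open import Data.Rational.Base using (ℚ; mkℚ; 0ℚ; 1ℚ; 1/_; _/_; _+_; _*_; _-_; -_; _≤_; _<_; _≥_; *≤*; *<*; ↥_; ≢-nonZero; positive; nonNegative) renaming (NonZero to NonZeroℚ)
open import Data.Rational.Properties hiding (_≟_)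
import Data.Rational.Properties as ℚ
open import Data.Sum.Base using (_⊎_; inj₁; inj₂; [_,_]′)
open import Data.Vec.Base using (Vec; []; _∷_; lookup; here; there; tabulate)
open import Data.Vec.Properties using ([]=⇒lookup; lookup⇒[]=; lookup∘tabulate)
open import Data.Vec.Relation.Unary.All using ([]; _∷_)
open import Data.Vec.Relation.Unary.All.Properties using (lookup⁻)
open import Function.Base using (_∘_)
open import Function.Bundles using (_⇔_; mk⇔)
open import Function.Definitions using (Injective)
open import Level using (0ℓ)
open import Relation.Binary.PropositionalEquality
open import Relation.Nullary.Decidable using (Dec; yes; no; does; dec⇒maybe; dec-true; dec-false)
open import Relation.Nullary.Negation using (¬_; contradiction)
open import Relation.Unary.Properties using (∁?)
open import Tactic.RingSolver using (solve-∀)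
open import Tactic.RingSolver.Core.AlmostCommutativeRing using (AlmostCommutativeRing; fromCommutativeRing)

-- Rational arithmetic and the embedding of ℕ.

ring : AlmostCommutativeRing 0ℓ 0ℓ
ring = fromCommutativeRing +-*-commutativeRing (λ p → dec⇒maybe (0ℚ ℚ.≟ p))

-- `fromℕ` normalises through a gcd that is stuck on a variable; the right side exposes numerator
-- and denominator, so that facts about integers can be transported.
fromℕ≡mkℚ : ∀ m → fromℕ m ≡ mkℚ (+ m) 0 (Coprimality.sym (Coprimality.1-coprimeTo m))
fromℕ≡mkℚ m = normalize-coprime (Coprimality.sym (Coprimality.1-coprimeTo m))

fromℕ-+ : ∀ m n → fromℕ (m ℕ.+ n) ≡ fromℕ m + fromℕ n
fromℕ-+ m n = sym (trans (cong₂ _+_ (fromℕ≡mkℚ m) (fromℕ≡mkℚ n))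
  (cong (_/ 1) (cong₂ ℤ._+_ (ℤ.*-identityʳ (+ m)) (ℤ.*-identityʳ (+ n)))))

fromℕ-* : ∀ m n → fromℕ (m ℕ.* n) ≡ fromℕ m * fromℕ n
fromℕ-* m n = sym (trans (cong₂ _*_ (fromℕ≡mkℚ m) (fromℕ≡mkℚ n))
  (cong (_/ 1) (sym (ℤ.pos-* m n))))

fromℕ-mono-≤ : ∀ {m n} → m ℕ.≤ n → fromℕ m ≤ fromℕ n
fromℕ-mono-≤ {m} {n} m≤n = subst₂ _≤_ (sym (fromℕ≡mkℚ m)) (sym (fromℕ≡mkℚ n))
  (*≤* (ℤ.*-monoʳ-≤-nonNeg (+ 1) (ℤ.+≤+ m≤n)))

fromℕ-mono-< : ∀ {m n} → m ℕ.< n → fromℕ m < fromℕ n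
fromℕ-mono-< {m} {n} m<n = subst₂ _<_ (sym (fromℕ≡mkℚ m)) (sym (fromℕ≡mkℚ n))
  (*<* (ℤ.*-monoʳ-<-pos (+ 1) (ℤ.+<+ m<n)))

fromℕ-injective : ∀ {m n} → fromℕ m ≡ fromℕ n → m ≡ n
fromℕ-injective {m} {n} eq = ℤ.+-injective
  (cong ↥_ (trans (sym (fromℕ≡mkℚ m)) (trans eq (fromℕ≡mkℚ n))))

fromℕ≥0 : ∀ m → 0ℚ ≤ fromℕ m
fromℕ≥0 m = fromℕ-mono-≤ {0} {m} z≤n

+-nonNeg : ∀ {p r} → 0ℚ ≤ p → 0ℚ ≤ r → 0ℚ ≤ p + r
+-nonNeg = +-mono-≤

*-nonNeg : ∀ {p r} → 0ℚ ≤ p → 0ℚ ≤ r → 0ℚ ≤ p * r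
*-nonNeg {p} {r} 0≤p 0≤r = subst (_≤ p * r) (*-zeroʳ p)
  (*-monoˡ-≤-nonNeg p {{nonNegative 0≤p}} 0≤r)

*-pos : ∀ {p r} → 0ℚ < p → 0ℚ < r → 0ℚ < p * r
*-pos {p} {r} 0<p 0<r = subst (_< p * r) (*-zeroʳ p)
  (*-monoʳ-<-pos p {{positive 0<p}} 0<r)

+-zero-summands : ∀ {p r} → 0ℚ ≤ p → 0ℚ ≤ r → p + r ≡ 0ℚ → p ≡ 0ℚ × r ≡ 0ℚ
+-zero-summands {p} {r} 0≤p 0≤r eq =
  ≤-antisym (subst₂ _≤_ (+-identityʳ p) eq (+-monoʳ-≤ p 0≤r)) 0≤p ,
  ≤-antisym (subst₂ _≤_ (+-identityˡ r) eq (+-monoˡ-≤ r 0≤p)) 0≤r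

*-cancelˡ-0 : ∀ p {r} → p ≢ 0ℚ → p * r ≡ 0ℚ → r ≡ 0ℚ
*-cancelˡ-0 p {r} p≢0 eq = begin
  r                 ≡⟨ *-identityˡ r ⟨
  1ℚ * r            ≡⟨ cong (_* r) (*-inverseˡ p) ⟨
  1/ p * p * r      ≡⟨ *-assoc (1/ p) p r ⟩
  1/ p * (p * r)    ≡⟨ cong (1/ p *_) eq ⟩
  1/ p * 0ℚ         ≡⟨ *-zeroʳ (1/ p) ⟩
  0ℚ                ∎
  where
  open ≡-Reasoning
  instance _ = ≢-nonZero p≢0

0≤p*p : ∀ p → 0ℚ ≤ p * p
0≤p*p p with ≤-total 0ℚ p
... | inj₁ 0≤p = *-nonNeg 0≤p 0≤p
... | inj₂ p≤0 = subst (0ℚ ≤_) (neg² p) (*-nonNeg (neg-antimono-≤ p≤0) (neg-antimono-≤ p≤0))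
  where
  neg² : ∀ p → (- p) * (- p) ≡ p * p
  neg² = solve-∀ ring

p*p≡0⇒p≡0 : ∀ p → p * p ≡ 0ℚ → p ≡ 0ℚ
p*p≡0⇒p≡0 p eq with p ℚ.≟ 0ℚ
... | yes p≡0 = p≡0
... | no  p≢0 = *-cancelˡ-0 p p≢0 eq

-- Linear functionals and finite sums.

record Linear {A : Set} (J : (A → ℚ) → ℚ) : Set where
  field
    J-cong : ∀ {f g} → f ≗ g → J f ≡ J g
    J-+    : ∀ f g → J (λ a → f a + g a) ≡ J f + J g
    J-*    : ∀ c f → J (λ a → c * f a) ≡ c * J f

  J-0 : ∀ {f} → (∀ a → f a ≡ 0ℚ) → J f ≡ 0ℚ
  J-0 {f} f≡0 = begin
    J f                   ≡⟨ J-cong (λ a → trans (f≡0 a) (sym (*-zeroˡ (f a)))) ⟩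
    J (λ a → 0ℚ * f a)    ≡⟨ J-* 0ℚ f ⟩
    0ℚ * J f              ≡⟨ *-zeroˡ (J f) ⟩
    0ℚ                    ∎
    where open ≡-Reasoning

  J-minus : ∀ f g → J (λ a → f a - g a) ≡ J f - J g
  J-minus f g = begin
    J (λ a → f a - g a)               ≡⟨ J-cong (λ a → minus (f a) (g a)) ⟩
    J (λ a → f a + (- 1ℚ) * g a)      ≡⟨ J-+ f _ ⟩
    J f + J (λ a → (- 1ℚ) * g a)      ≡⟨ cong (_+_ (J f)) (J-* (- 1ℚ) g) ⟩
    J f + (- 1ℚ) * J g                ≡⟨ minus (J f) (J g) ⟨
    J f - J g                         ∎
    where
    open ≡-Reasoning
    minus : ∀ x y → x - y ≡ x + (- 1ℚ) * y
    minus = solve-∀ ring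

open Linear

module _ {A : Set} where

  at-linear : (a : A) → Linear (λ f → f a)
  at-linear a = record { J-cong = λ f≗g → f≗g a ; J-+ = λ _ _ → refl ; J-* = λ _ _ → refl }

  *-linear : ∀ c {J : (A → ℚ) → ℚ} → Linear J → Linear (λ f → c * J f)
  *-linear c {J} lin = record
    { J-cong = λ f≗g → cong (c *_) (J-cong lin f≗g)
    ; J-+    = λ f g → trans (cong (c *_) (J-+ lin f g)) (*-distribˡ-+ c (J f) (J g))
    ; J-*    = λ d f → trans (cong (c *_) (J-* lin d f)) (swap c d (J f))
    }
    where
    swap : ∀ x y z → x * (y * z) ≡ y * (x * z)
    swap = solve-∀ ring

  +-linear : ∀ {J K : (A → ℚ) → ℚ} → Linear J → Linear K → Linear (λ f → J f + K f)
  +-linear {J} {K} lin lin′ = record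
    { J-cong = λ f≗g → cong₂ _+_ (J-cong lin f≗g) (J-cong lin′ f≗g)
    ; J-+    = λ f g → trans (cong₂ _+_ (J-+ lin f g) (J-+ lin′ f g)) (swap (J f) (J g) (K f) (K g))
    ; J-*    = λ c f → trans (cong₂ _+_ (J-* lin c f) (J-* lin′ c f)) (sym (*-distribˡ-+ c (J f) (K f)))
    }
    where
    swap : ∀ x y z w → (x + y) + (z + w) ≡ (x + z) + (y + w)
    swap = solve-∀ ring

  −-linear : ∀ {J K : (A → ℚ) → ℚ} → Linear J → Linear K → Linear (λ f → J f - K f)
  −-linear {J} {K} lin lin′ = record
    { J-cong = λ f≗g → cong₂ _-_ (J-cong lin f≗g) (J-cong lin′ f≗g)
    ; J-+    = λ f g → trans (cong₂ _-_ (J-+ lin f g) (J-+ lin′ f g)) (swap (J f) (J g) (K f) (K g))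
    ; J-*    = λ c f → trans (cong₂ _-_ (J-* lin c f) (J-* lin′ c f)) (factor c (J f) (K f))
    }
    where
    swap : ∀ x y z w → (x + y) - (z + w) ≡ (x - z) + (y - w)
    swap = solve-∀ ring
    factor : ∀ x y z → x * y - x * z ≡ x * (y - z)
    factor = solve-∀ ring

  ∘-linear : ∀ {B : Set} {J : (B → ℚ) → ℚ} {K : B → (A → ℚ) → ℚ} →
             Linear J → (∀ b → Linear (K b)) → Linear (λ f → J (λ b → K b f))
  ∘-linear lin lin′ = record
    { J-cong = λ f≗g → J-cong lin (λ b → J-cong (lin′ b) f≗g)
    ; J-+    = λ f g → trans (J-cong lin (λ b → J-+ (lin′ b) f g)) (J-+ lin _ _)
    ; J-*    = λ c f → trans (J-cong lin (λ b → J-* (lin′ b) c f)) (J-* lin c _)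
    }

-- `interchange` allows any linear functional, not just another sum: it is applied to operators such
-- as `M T` and `L` evaluated at a point.
record IsSum {A : Set} (I : (A → ℚ) → ℚ) : Set₁ where
  field
    linear      : Linear I
    nonNeg      : ∀ {f} → (∀ a → 0ℚ ≤ f a) → 0ℚ ≤ I f
    definite    : ∀ {f} → (∀ a → 0ℚ ≤ f a) → I f ≡ 0ℚ → ∀ a → f a ≡ 0ℚ
    interchange : ∀ {B : Set} {J : (B → ℚ) → ℚ} → Linear J → (f : A → B → ℚ) →
                  I (λ a → J (f a)) ≡ J (λ b → I (λ a → f a b))
  open Linear linear public

open IsSum using (linear; nonNeg; definite; interchange)

∑ℚ-isSum : ∀ {n} → IsSum (∑ℚ {n})
∑ℚ-isSum = record
  { linear = record { J-cong = S.sum-cong-≗ ; J-+ = S.∑-distrib-+ ; J-* = λ c f → sym (S.*-distribˡ-sum c f) }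
  ; nonNeg = ∑ℚ-nonNeg
  ; definite = ∑ℚ-definite
  ; interchange = ∑ℚ-interchange
  }
  where
  module S = SemiringSum (CommutativeRing.semiring +-*-commutativeRing)

  ∑ℚ-nonNeg : ∀ {n} {f : Fin n → ℚ} → (∀ a → 0ℚ ≤ f a) → 0ℚ ≤ ∑ℚ f
  ∑ℚ-nonNeg {zero}  f≥0 = ≤-refl
  ∑ℚ-nonNeg {suc n} f≥0 = +-nonNeg (f≥0 zero) (∑ℚ-nonNeg (λ a → f≥0 (suc a)))

  ∑ℚ-definite : ∀ {n} {f : Fin n → ℚ} → (∀ a → 0ℚ ≤ f a) → ∑ℚ f ≡ 0ℚ → ∀ a → f a ≡ 0ℚ
  ∑ℚ-definite {suc n} f≥0 eq a
    with +-zero-summands (f≥0 zero) (∑ℚ-nonNeg (λ a → f≥0 (suc a))) eq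
  ∑ℚ-definite f≥0 eq zero    | f₀≡0 , _    = f₀≡0
  ∑ℚ-definite f≥0 eq (suc a) | _    , eq′  = ∑ℚ-definite (λ a → f≥0 (suc a)) eq′ a

  ∑ℚ-interchange : ∀ {n} {B : Set} {J : (B → ℚ) → ℚ} → Linear J → (f : Fin n → B → ℚ) →
                   ∑ℚ (λ a → J (f a)) ≡ J (λ b → ∑ℚ (λ a → f a b))
  ∑ℚ-interchange {zero}      lin f = sym (J-0 lin (λ _ → refl))
  ∑ℚ-interchange {suc n} {J = J} lin f = trans
    (cong (_+_ (J (f zero))) (∑ℚ-interchange lin (λ a → f (suc a))))
    (sym (J-+ lin (f zero) _))

∑Vℚ : ∀ {n} {qs : Vec ℕ n} → (Vertex qs → ℚ) → ℚ
∑Vℚ {qs = []}     f = f []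
∑Vℚ {qs = q ∷ qs} f = ∑ℚ λ a → ∑Vℚ λ x → f (a ∷ x)

∑Vℚ-isSum : ∀ {n} {qs : Vec ℕ n} → IsSum (∑Vℚ {qs = qs})
∑Vℚ-isSum {qs = []} = record
  { linear      = at-linear []
  ; nonNeg      = λ f≥0 → f≥0 []
  ; definite    = λ { f≥0 eq [] → eq }
  ; interchange = λ lin f → refl
  }
∑Vℚ-isSum {qs = q ∷ qs} = record
  { linear      = ∘-linear (linear ∑ℚ-isSum) (λ a → ∘-linear (linear ∑Vℚ-isSum) (λ x → at-linear (a ∷ x)))
  ; nonNeg      = λ f≥0 → nonNeg ∑ℚ-isSum (λ a → nonNeg ∑Vℚ-isSum (λ x → f≥0 (a ∷ x)))
  ; definite    = λ { f≥0 eq (a ∷ x) → definite ∑Vℚ-isSum (λ x → f≥0 (a ∷ x))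
                      (definite ∑ℚ-isSum (λ a → nonNeg ∑Vℚ-isSum (λ x → f≥0 (a ∷ x))) eq a) x }
  ; interchange = λ lin f → trans
      (IsSum.J-cong ∑ℚ-isSum (λ a → interchange ∑Vℚ-isSum lin (λ x → f (a ∷ x))))
      (interchange ∑ℚ-isSum lin (λ a b → ∑Vℚ (λ x → f (a ∷ x) b)))
  }

∑S : ∀ {n} → (Subset n → ℚ) → ℚ
∑S {zero}  h = h []
∑S {suc n} h = ∑S (λ S → h (outside ∷ S)) + ∑S (λ S → h (inside ∷ S))

∑S-isSum : ∀ {n} → IsSum (∑S {n})
∑S-isSum {zero} = record
  { linear      = at-linear []
  ; nonNeg      = λ f≥0 → f≥0 []
  ; definite    = λ { f≥0 eq [] → eq }
  ; interchange = λ lin f → refl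
  }
∑S-isSum {suc n} = record
  { linear      = +-linear (half outside) (half inside)
  ; nonNeg      = λ f≥0 → +-nonNeg (half≥0 f≥0 outside) (half≥0 f≥0 inside)
  ; definite    = λ { f≥0 eq (outside ∷ S) → definite ∑S-isSum (λ S → f≥0 (outside ∷ S))
                        (proj₁ (+-zero-summands (half≥0 f≥0 outside) (half≥0 f≥0 inside) eq)) S
                    ; f≥0 eq (inside ∷ S)  → definite ∑S-isSum (λ S → f≥0 (inside ∷ S))
                        (proj₂ (+-zero-summands (half≥0 f≥0 outside) (half≥0 f≥0 inside) eq)) S }
  ; interchange = λ lin f → trans
      (cong₂ _+_ (interchange ∑S-isSum lin (λ S → f (outside ∷ S)))
                 (interchange ∑S-isSum lin (λ S → f (inside ∷ S))))
      (sym (J-+ lin _ _))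
  }
  where
  half : ∀ s → Linear (λ h → ∑S {n} (λ S → h (s ∷ S)))
  half s = ∘-linear (linear ∑S-isSum) (λ S → at-linear (s ∷ S))
  half≥0 : ∀ {h : Subset (suc n) → ℚ} → (∀ S → 0ℚ ≤ h S) → ∀ s → 0ℚ ≤ ∑S (λ S → h (s ∷ S))
  half≥0 h≥0 s = nonNeg ∑S-isSum (λ S → h≥0 (s ∷ S))

fromℕ-∑ : ∀ {n} (f : Fin n → ℕ) → fromℕ (∑ f) ≡ ∑ℚ (λ a → fromℕ (f a))
fromℕ-∑ {zero}  f = refl
fromℕ-∑ {suc n} f = trans (fromℕ-+ (f zero) _) (cong (_+_ (fromℕ (f zero))) (fromℕ-∑ (λ a → f (suc a))))

fromℕ-∑V : ∀ {n} {qs : Vec ℕ n} (f : Vertex qs → ℕ) → fromℕ (∑V f) ≡ ∑Vℚ (λ x → fromℕ (f x))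
fromℕ-∑V {qs = []}     f = refl
fromℕ-∑V {qs = q ∷ qs} f = trans (fromℕ-∑ (λ a → ∑V (λ x → f (a ∷ x)))) (IsSum.J-cong ∑ℚ-isSum (λ a → fromℕ-∑V (λ x → f (a ∷ x))))

∑ℚ-const : ∀ n c → ∑ℚ {n} (λ _ → c) ≡ fromℕ n * c
∑ℚ-const zero    c = sym (*-zeroˡ c)
∑ℚ-const (suc n) c = begin
  c + ∑ℚ {n} (λ _ → c)     ≡⟨ cong (_+_ c) (∑ℚ-const n c) ⟩
  c + fromℕ n * c          ≡⟨ factor c (fromℕ n) ⟩
  (1ℚ + fromℕ n) * c       ≡⟨ cong (_* c) (fromℕ-+ 1 n) ⟨
  fromℕ (suc n) * c        ∎
  where
  open ≡-Reasoning
  factor : ∀ x y → x + y * x ≡ (1ℚ + y) * x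
  factor = solve-∀ ring

private
  module ∑ℚ {n} = IsSum (∑ℚ-isSum {n})
  module ∑Vℚ {n} {qs : Vec ℕ n} = IsSum (∑Vℚ-isSum {qs = qs})
  module ∑S {n} = IsSum (∑S-isSum {n})

-- Averaging over the first coordinate.

-- Junk value: inv 0 = 0.
inv : ℕ → ℚ
inv zero    = 0ℚ
inv (suc m) = + 1 / suc m

*-inv : ∀ m → fromℕ (suc m) * inv (suc m) ≡ 1ℚ
*-inv m = trans
  (cong₂ _*_ (fromℕ≡mkℚ (suc m)) (normalize-coprime (Coprimality.1-coprimeTo (suc m))))
  (*-inverseʳ (mkℚ +[1+ m ] 0 (Coprimality.sym (Coprimality.1-coprimeTo (suc m)))))

module _ {n q : ℕ} {qs : Vec ℕ n} where

  E : (Vertex (q ∷ qs) → ℚ) → Vertex qs → ℚ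
  E f x = inv q * ∑ℚ λ a → f (a ∷ x)

  E-linear : ∀ x → Linear (λ f → E f x)
  E-linear x = *-linear (inv q) (∘-linear ∑ℚ.linear (λ a → at-linear (a ∷ x)))

  -- `E` is a weighted finite sum over the first coordinate, so a linear functional of the remaining
  -- coordinates passes through it.
  E-commutes : ∀ {J : (Vertex qs → ℚ) → ℚ} → Linear J → ∀ f →
               inv q * ∑ℚ (λ a → J (λ x → f (a ∷ x))) ≡ J (E f)
  E-commutes {J} lin f = trans
    (cong (inv q *_) (∑ℚ.interchange lin (λ a x → f (a ∷ x))))
    (sym (J-* lin (inv q) (λ x → ∑ℚ (λ a → f (a ∷ x)))))

  q*E : ∀ f x → fromℕ q * E f x ≡ ∑ℚ (λ a → f (a ∷ x))
  q*E f x = q*inv*∑ (λ a → f (a ∷ x))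
    where
    q*inv*∑ : ∀ {q} (h : Fin q → ℚ) → fromℕ q * (inv q * ∑ℚ h) ≡ ∑ℚ h
    q*inv*∑ {zero}  h = *-zeroˡ (0ℚ * 0ℚ)
    q*inv*∑ {suc m} h = trans (sym (*-assoc (fromℕ (suc m)) (inv (suc m)) (∑ℚ h)))
      (trans (cong (_* ∑ℚ h) (*-inv m)) (*-identityˡ (∑ℚ h)))

  ∑-deviation : ∀ f x → ∑ℚ (λ a → f (a ∷ x) - E f x) ≡ 0ℚ
  ∑-deviation f x = begin
    ∑ℚ (λ a → f (a ∷ x) - E f x)                 ≡⟨ ∑ℚ.J-minus (λ a → f (a ∷ x)) (λ _ → E f x) ⟩
    ∑ℚ (λ a → f (a ∷ x)) - ∑ℚ {q} (λ _ → E f x)  ≡⟨ cong₂ _-_ (sym (q*E f x)) (∑ℚ-const q (E f x)) ⟩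
    fromℕ q * E f x - fromℕ q * E f x            ≡⟨ +-inverseʳ (fromℕ q * E f x) ⟩
    0ℚ                                           ∎
    where open ≡-Reasoning

-- The element of `Fin q` is evidence that `q` is positive; in the uses it is the head of the vertex
-- at hand.
E-const : ∀ {q} → Fin q → ∀ c → inv q * ∑ℚ {q} (λ _ → c) ≡ c
E-const {suc m} _ c = begin
  inv (suc m) * ∑ℚ {suc m} (λ _ → c)     ≡⟨ cong (inv (suc m) *_) (∑ℚ-const (suc m) c) ⟩
  inv (suc m) * (fromℕ (suc m) * c)      ≡⟨ shuffle (inv (suc m)) (fromℕ (suc m)) c ⟩
  fromℕ (suc m) * inv (suc m) * c        ≡⟨ cong (_* c) (*-inv m) ⟩
  1ℚ * c                                 ≡⟨ *-identityˡ c ⟩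
  c                                      ∎
  where
  open ≡-Reasoning
  shuffle : ∀ x y z → x * (y * z) ≡ y * x * z
  shuffle = solve-∀ ring

-- Orthogonal components.

-- P S f is the component of f in the common eigenspace of the coordinate averages E_i
-- given by E_i = 0 for i ∈ S and E_i = 1 for i ∉ S.
P : ∀ {n} {qs : Vec ℕ n} → Subset n → (Vertex qs → ℚ) → Vertex qs → ℚ
P []            f []      = f []
P (outside ∷ S) f (a ∷ x) = P S (E f) x
P (inside  ∷ S) f (a ∷ x) = P S (λ y → f (a ∷ y) - E f y) x

P-linear : ∀ {n} {qs : Vec ℕ n} S (x : Vertex qs) → Linear (λ f → P S f x)
P-linear []            []      = at-linear []
P-linear (outside ∷ S) (a ∷ x) = ∘-linear (P-linear S x) E-linear
P-linear (inside  ∷ S) (a ∷ x) =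
  ∘-linear (P-linear S x) (λ y → −-linear (at-linear (a ∷ y)) (E-linear y))

-- In each coordinate `f` is its average plus its deviation, which are the `outside` and `inside`
-- branches of `P`.
∑S-P : ∀ {n} {qs : Vec ℕ n} (f : Vertex qs → ℚ) x → ∑S (λ S → P S f x) ≡ f x
∑S-P f []      = refl
∑S-P f (a ∷ x) = trans
  (cong₂ _+_ (∑S-P (E f) x) (∑S-P (λ y → f (a ∷ y) - E f y) x))
  (cancel (E f x) (f (a ∷ x)))
  where
  cancel : ∀ x y → x + (y - x) ≡ y
  cancel = solve-∀ ring

-- This is 1/|V| when all entries are positive.
invs : ∀ {n} → Vec ℕ n → ℚ
invs []       = 1ℚ
invs (q ∷ qs) = inv q * invs qs

P-⊥ : ∀ {n} {qs : Vec ℕ n} (f : Vertex qs → ℚ) x → P ⊥ f x ≡ invs qs * ∑Vℚ f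
P-⊥ f [] = sym (*-identityˡ (f []))
P-⊥ {qs = q ∷ qs} f (a ∷ x) = begin
  P ⊥ (E f) x                                            ≡⟨ P-⊥ (E f) x ⟩
  invs qs * ∑Vℚ (E f)                                    ≡⟨ cong (invs qs *_) (E-commutes ∑Vℚ.linear f) ⟨
  invs qs * (inv q * ∑Vℚ f)                              ≡⟨ shuffle (invs qs) (inv q) (∑Vℚ f) ⟩
  inv q * invs qs * ∑Vℚ f                                ∎
  where
  open ≡-Reasoning
  shuffle : ∀ x y z → x * (y * z) ≡ y * x * z
  shuffle = solve-∀ ring

-- A nonempty `S` makes `P S` take the deviation in some coordinate, and a constant has none.
P-const : ∀ {n} {qs : Vec ℕ n} S → 0 ℕ.< ∣ S ∣ → ∀ c (x : Vertex qs) → P S (λ _ → c) x ≡ 0ℚ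
P-const (outside ∷ S) 0<∣S∣ c (a ∷ x) =
  trans (J-cong (P-linear S x) (λ y → E-const a c)) (P-const S 0<∣S∣ c x)
P-const (inside ∷ S) 0<∣S∣ c (a ∷ x) =
  J-0 (P-linear S x) (λ y → trans (cong (λ r → c - r) (E-const a c)) (+-inverseʳ c))

∑S-⊥ : ∀ {n} (h : Subset n → ℚ) → (∀ S → 0 ℕ.< ∣ S ∣ → h S ≡ 0ℚ) → ∑S h ≡ h ⊥
∑S-⊥ {zero}  h h≡0 = refl
∑S-⊥ {suc n} h h≡0 = trans
  (cong₂ _+_ (∑S-⊥ (λ S → h (outside ∷ S)) (λ S → h≡0 (outside ∷ S)))
             (∑S.J-0 (λ S → h≡0 (inside ∷ S) (s≤s z≤n))))
  (+-identityʳ (h ⊥))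

-- Partial averages and their components.

-- M T averages over the coordinates outside T.
M : ∀ {n} {qs : Vec ℕ n} → Subset n → (Vertex qs → ℚ) → Vertex qs → ℚ
M []            f []      = f []
M (outside ∷ T) f (a ∷ x) = M T (E f) x
M (inside  ∷ T) f (a ∷ x) = M T (λ y → f (a ∷ y)) x

M-linear : ∀ {n} {qs : Vec ℕ n} T (x : Vertex qs) → Linear (λ f → M T f x)
M-linear []            []      = at-linear []
M-linear (outside ∷ T) (a ∷ x) = ∘-linear (M-linear T x) E-linear
M-linear (inside  ∷ T) (a ∷ x) = ∘-linear (M-linear T x) (λ y → at-linear (a ∷ y))

-- The coordinates averaged by `M T` lie outside `S`, where `P S` averages as well, and averaging
-- twice is averaging once.
P-M-⊆ : ∀ {n} {qs : Vec ℕ n} S T → S ⊆ T → ∀ f (x : Vertex qs) → P S (M T f) x ≡ P S f x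
P-M-⊆ []            []            S⊆T f []      = refl
P-M-⊆ (outside ∷ S) (outside ∷ T) S⊆T f (a ∷ x) = trans
  (J-cong (P-linear S x) (λ y → E-const a (M T (E f) y)))
  (P-M-⊆ S T (drop-∷-⊆ S⊆T) (E f) x)
P-M-⊆ (outside ∷ S) (inside ∷ T)  S⊆T f (a ∷ x) = trans
  (J-cong (P-linear S x) (λ y → E-commutes (M-linear T y) f))
  (P-M-⊆ S T (drop-∷-⊆ S⊆T) (E f) x)
P-M-⊆ (inside ∷ S)  (inside ∷ T)  S⊆T f (a ∷ x) = trans
  (J-cong (P-linear S x) (λ y → trans
    (cong (λ r → M T (λ z → f (a ∷ z)) y - r) (E-commutes (M-linear T y) f))
    (sym (J-minus (M-linear T y) (λ z → f (a ∷ z)) (E f)))))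
  (P-M-⊆ S T (drop-∷-⊆ S⊆T) (λ y → f (a ∷ y) - E f y) x)
P-M-⊆ (inside ∷ S)  (outside ∷ T) S⊆T f (a ∷ x) with () ← S⊆T here

-- Some coordinate lies in `S` but not in `T`. There `M T f` is constant, so the deviation taken by
-- `P S` is zero.
P-M-⊈ : ∀ {n} {qs : Vec ℕ n} S T → S ⊈ T → ∀ f (x : Vertex qs) → P S (M T f) x ≡ 0ℚ
P-M-⊈ []            []            S⊈T f []      = contradiction (λ ()) S⊈T
P-M-⊈ (outside ∷ S) (outside ∷ T) S⊈T f (a ∷ x) = trans
  (J-cong (P-linear S x) (λ y → E-const a (M T (E f) y)))
  (P-M-⊈ S T (λ S⊆T → S⊈T (out⊆ S⊆T)) (E f) x)
P-M-⊈ (outside ∷ S) (inside ∷ T)  S⊈T f (a ∷ x) = trans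
  (J-cong (P-linear S x) (λ y → E-commutes (M-linear T y) f))
  (P-M-⊈ S T (λ S⊆T → S⊈T (out⊆ S⊆T)) (E f) x)
P-M-⊈ (inside ∷ S)  (inside ∷ T)  S⊈T f (a ∷ x) = trans
  (J-cong (P-linear S x) (λ y → trans
    (cong (λ r → M T (λ z → f (a ∷ z)) y - r) (E-commutes (M-linear T y) f))
    (sym (J-minus (M-linear T y) (λ z → f (a ∷ z)) (E f)))))
  (P-M-⊈ S T (λ S⊆T → S⊈T (in⊆in S⊆T)) (λ y → f (a ∷ y) - E f y) x)
P-M-⊈ (inside ∷ S)  (outside ∷ T) S⊈T f (a ∷ x) = J-0 (P-linear S x) (λ y → trans
  (cong (λ r → M T (E f) y - r) (E-const a (M T (E f) y)))
  (+-inverseʳ (M T (E f) y)))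

-- The operator L and its eigenvalues.

-- L = Σ_i (I − E_i).
L : ∀ {n} {qs : Vec ℕ n} → (Vertex qs → ℚ) → Vertex qs → ℚ
L f []      = 0ℚ
L f (a ∷ x) = (f (a ∷ x) - E f x) + L (λ y → f (a ∷ y)) x

L-linear : ∀ {n} {qs : Vec ℕ n} (x : Vertex qs) → Linear (λ f → L f x)
L-linear [] = record { J-cong = λ _ → refl ; J-+ = λ _ _ → refl ; J-* = λ c f → sym (*-zeroʳ c) }
L-linear (a ∷ x) = +-linear (−-linear (at-linear (a ∷ x)) (E-linear x))
  (∘-linear (L-linear x) (λ y → at-linear (a ∷ y)))

-- The summand of `L` for the first coordinate averages to zero, and the other summands commute with
-- `E`.
E-L : ∀ {n q} {qs : Vec ℕ n} (f : Vertex (q ∷ qs) → ℚ) x → E (L f) x ≡ L (E f) x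
E-L {q = q} f x = begin
  inv q * ∑ℚ (λ a → (f (a ∷ x) - E f x) + L (λ y → f (a ∷ y)) x)
    ≡⟨ cong (inv q *_) (∑ℚ.J-+ (λ a → f (a ∷ x) - E f x) (λ a → L (λ y → f (a ∷ y)) x)) ⟩
  inv q * (∑ℚ (λ a → f (a ∷ x) - E f x) + ∑ℚ (λ a → L (λ y → f (a ∷ y)) x))
    ≡⟨ cong (λ r → inv q * (r + ∑ℚ (λ a → L (λ y → f (a ∷ y)) x))) (∑-deviation f x) ⟩
  inv q * (0ℚ + ∑ℚ (λ a → L (λ y → f (a ∷ y)) x))
    ≡⟨ cong (inv q *_) (+-identityˡ (∑ℚ (λ a → L (λ y → f (a ∷ y)) x))) ⟩
  inv q * ∑ℚ (λ a → L (λ y → f (a ∷ y)) x)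
    ≡⟨ E-commutes (L-linear x) f ⟩
  L (E f) x ∎
  where open ≡-Reasoning

-- Each I - E_i acts on the component as 1 if i ∈ S and as 0 otherwise. In the `inside` case, `L f`
-- minus its average is `g + L g` for the deviation `g`, which contributes the extra 1.
P-L : ∀ {n} {qs : Vec ℕ n} S f (x : Vertex qs) → P S (L f) x ≡ fromℕ ∣ S ∣ * P S f x
P-L []            f []      = sym (*-zeroˡ (f []))
P-L (outside ∷ S) f (a ∷ x) = trans (J-cong (P-linear S x) (E-L f)) (P-L S (E f) x)
P-L (inside ∷ S)  f (a ∷ x) = begin
  P S (λ y → L f (a ∷ y) - E (L f) y) x
    ≡⟨ J-cong (P-linear S x) (λ y → trans (cong (λ r → L f (a ∷ y) - r) (E-L f y)) (trans
        (assoc (g y) (L (λ z → f (a ∷ z)) y) (L (E f) y))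
        (cong (_+_ (g y)) (sym (J-minus (L-linear y) (λ z → f (a ∷ z)) (E f)))))) ⟩
  P S (λ y → g y + L g y) x
    ≡⟨ J-+ (P-linear S x) g (L g) ⟩
  P S g x + P S (L g) x
    ≡⟨ cong (_+_ (P S g x)) (P-L S g x) ⟩
  P S g x + fromℕ ∣ S ∣ * P S g x
    ≡⟨ factor (P S g x) (fromℕ ∣ S ∣) ⟩
  (1ℚ + fromℕ ∣ S ∣) * P S g x
    ≡⟨ cong (_* P S g x) (fromℕ-+ 1 ∣ S ∣) ⟨
  fromℕ (suc ∣ S ∣) * P S g x ∎
  where
  open ≡-Reasoning
  g : Vertex _ → ℚ
  g y = f (a ∷ y) - E f y
  assoc : ∀ x y z → (x + y) - z ≡ x + (y - z)
  assoc = solve-∀ ring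
  factor : ∀ x y → x + y * x ≡ (1ℚ + y) * x
  factor = solve-∀ ring

-- Parseval's identity.

-- Along every line in the first coordinate the average and the deviation are orthogonal, because
-- deviations sum to zero. Induction then treats the two parts separately.
parseval : ∀ {n} {qs : Vec ℕ n} (f g : Vertex qs → ℚ) →
           ∑S (λ S → ∑Vℚ (λ x → P S f x * P S g x)) ≡ ∑Vℚ (λ x → f x * g x)
parseval {qs = []}     f g = refl
parseval {qs = q ∷ qs} f g = begin
  ∑S (λ S → ∑ℚ {q} (λ a → ∑Vℚ (λ x → P S (E f) x * P S (E g) x))) +
  ∑S (λ S → ∑ℚ (λ a → ∑Vℚ (λ x → P S (f′ a) x * P S (g′ a) x)))
    ≡⟨ cong₂ _+_
         (∑S.interchange (∑ℚ.linear {q}) (λ S a → ∑Vℚ (λ x → P S (E f) x * P S (E g) x)))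
         (∑S.interchange ∑ℚ.linear (λ S a → ∑Vℚ (λ x → P S (f′ a) x * P S (g′ a) x))) ⟩
  ∑ℚ {q} (λ a → ∑S (λ S → ∑Vℚ (λ x → P S (E f) x * P S (E g) x))) +
  ∑ℚ (λ a → ∑S (λ S → ∑Vℚ (λ x → P S (f′ a) x * P S (g′ a) x)))
    ≡⟨ cong₂ _+_ (∑ℚ.J-cong {q} (λ a → parseval (E f) (E g)))
                 (∑ℚ.J-cong (λ a → parseval (f′ a) (g′ a))) ⟩
  ∑ℚ {q} (λ a → ∑Vℚ (λ x → E f x * E g x)) + ∑ℚ (λ a → ∑Vℚ (λ x → f′ a x * g′ a x))
    ≡⟨ cong₂ _+_ (∑ℚ.interchange {q} ∑Vℚ.linear (λ a x → E f x * E g x))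
                 (∑ℚ.interchange ∑Vℚ.linear (λ a x → f′ a x * g′ a x)) ⟩
  ∑Vℚ (λ x → ∑ℚ {q} (λ a → E f x * E g x)) + ∑Vℚ (λ x → ∑ℚ (λ a → f′ a x * g′ a x))
    ≡⟨ ∑Vℚ.J-+ (λ x → ∑ℚ {q} (λ a → E f x * E g x)) (λ x → ∑ℚ (λ a → f′ a x * g′ a x)) ⟨
  ∑Vℚ (λ x → ∑ℚ {q} (λ a → E f x * E g x) + ∑ℚ (λ a → f′ a x * g′ a x))
    ≡⟨ ∑Vℚ.J-cong pythagoras ⟩
  ∑Vℚ (λ x → ∑ℚ (λ a → f (a ∷ x) * g (a ∷ x)))
    ≡⟨ ∑ℚ.interchange ∑Vℚ.linear (λ a x → f (a ∷ x) * g (a ∷ x)) ⟨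
  ∑Vℚ (λ x → f x * g x) ∎
  where
  open ≡-Reasoning
  f′ g′ : Fin q → Vertex qs → ℚ
  f′ a x = f (a ∷ x) - E f x
  g′ a x = g (a ∷ x) - E g x

  -- The deviation of `g` is left intact in the correction term, so that its sum is given by
  -- `∑-deviation`, and the sum of the other part by `q*E`.
  expand : ∀ u v m m′ → (u - m) * (v - m′) ≡ u * v - (m * (v - m′) + m′ * u)
  expand = solve-∀ ring
  collect : ∀ q m m′ s → q * (m * m′) + (s - (m * 0ℚ + m′ * (q * m))) ≡ s
  collect = solve-∀ ring

  pythagoras : ∀ x → ∑ℚ {q} (λ a → E f x * E g x) + ∑ℚ (λ a → f′ a x * g′ a x) ≡
                     ∑ℚ (λ a → f (a ∷ x) * g (a ∷ x))
  pythagoras x = begin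
    ∑ℚ {q} (λ a → m * m′) + ∑ℚ (λ a → f′ a x * g′ a x)
      ≡⟨ cong₂ _+_ (∑ℚ-const q (m * m′)) (∑ℚ.J-cong (λ a → expand (f (a ∷ x)) (g (a ∷ x)) m m′)) ⟩
    fromℕ q * (m * m′) + ∑ℚ (λ a → f (a ∷ x) * g (a ∷ x) - (m * g′ a x + m′ * f (a ∷ x)))
      ≡⟨ cong (_+_ (fromℕ q * (m * m′))) (trans
           (∑ℚ.J-minus (λ a → f (a ∷ x) * g (a ∷ x)) (λ a → m * g′ a x + m′ * f (a ∷ x)))
           (cong (λ r → s - r) (∑ℚ.J-+ (λ a → m * g′ a x) (λ a → m′ * f (a ∷ x))))) ⟩
    fromℕ q * (m * m′) + (s - (∑ℚ (λ a → m * g′ a x) + ∑ℚ (λ a → m′ * f (a ∷ x))))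
      ≡⟨ cong (λ r → fromℕ q * (m * m′) + (s - r)) (cong₂ _+_
           (trans (∑ℚ.J-* m (λ a → g′ a x)) (cong (m *_) (∑-deviation g x)))
           (trans (∑ℚ.J-* m′ (λ a → f (a ∷ x))) (cong (m′ *_) (sym (q*E f x))))) ⟩
    fromℕ q * (m * m′) + (s - (m * 0ℚ + m′ * (fromℕ q * m)))
      ≡⟨ collect (fromℕ q) m m′ s ⟩
    s ∎
    where
    m = E f x
    m′ = E g x
    s = ∑ℚ (λ a → f (a ∷ x) * g (a ∷ x))

-- Sums over the image of an injection.

module _ {c ℓ} (CM : CommutativeMonoid c ℓ) where
  open CommutativeMonoid CM renaming (refl to ≈-refl; sym to ≈-sym; trans to ≈-trans; reflexive to ≈-reflexive)
  open MonoidSum CM using (sum; sum-cong-≋; sum-replicate-zero; ∑-distrib-+)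

  sum-δ : ∀ {n} (k : Fin n) (h : Fin n → Carrier) → sum (λ l → if does (k ≟ l) then h l else ε) ≈ h k
  sum-δ {suc n} zero    h = ≈-trans (∙-congˡ (sum-replicate-zero n)) (identityʳ (h zero))
  sum-δ {suc n} (suc k) h = ≈-trans (identityˡ _) (sum-δ k (h ∘ suc))

  -- For an arbitrary commutative monoid, since it serves both products of alphabet sizes and
  -- cardinalities.
  sum-image : ∀ {t n} (i : Fin t → Fin n) → Injective _≡_ _≡_ i → (h : Fin n → Carrier) →
              sum (h ∘ i) ≈ sum (λ k → if does (any? (λ j → i j ≟ k)) then h k else ε)
  sum-image {zero}  {n} i inj h = ≈-sym (sum-replicate-zero n)
  sum-image {suc t} {n} i inj h = ≈-sym (≈-trans (sum-cong-≋ split) (≈-trans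
    (∑-distrib-+ (λ k → if does (i zero ≟ k) then h k else ε) (λ k → if rest k then h k else ε))
    (∙-cong (sum-δ (i zero) h) (≈-sym (sum-image (i ∘ suc) (suc-injective ∘ inj) h)))))
    where
    rest : Fin n → Bool
    rest k = does (any? (λ j → i (suc j) ≟ k))

    split : ∀ k → (if does (any? (λ j → i j ≟ k)) then h k else ε) ≈
                  (if does (i zero ≟ k) then h k else ε) ∙ (if rest k then h k else ε)
    split k with i zero ≟ k
    ... | no  _   = ≈-sym (identityˡ _)
    -- By injectivity no later index hits `i zero` again, so the second summand is `ε`.
    ... | yes i₀≡k = ≈-sym (≈-trans
      (∙-congˡ (≈-reflexive (cong (λ b → if b then h k else ε)
        (dec-false (any? (λ j → i (suc j) ≟ k)) λ { (j , iⱼ≡k) → 0≢1+n (inj (trans i₀≡k (sym iⱼ≡k))) }))))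
      (identityʳ (h k)))

fromℕ-if : ∀ b m → fromℕ (if b then m else 0) ≡ (if b then fromℕ m else 0ℚ)
fromℕ-if true  m = refl
fromℕ-if false m = refl

does-≡ : ∀ {A : Set} (A? : Dec A) {b} → (A → b ≡ true) → (b ≡ true → A) → does A? ≡ b
does-≡ (yes a) {b}     to from = sym (to a)
does-≡ (no ¬a) {true}  to from = contradiction (from refl) ¬a
does-≡ (no ¬a) {false} to from = refl

if-linear : ∀ {A : Set} b (a : A) → Linear (λ f → if b then f a else 0ℚ)
if-linear true  a = at-linear a
if-linear false a = record { J-cong = λ _ → refl ; J-+ = λ _ _ → refl ; J-* = λ c _ → sym (*-zeroʳ c) }

∑ℚ-δ : ∀ {n} (k : Fin n) (h : Fin n → ℚ) → ∑ℚ (λ l → if does (k ≟ l) then h l else 0ℚ) ≡ h k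
∑ℚ-δ = sum-δ +-0-commutativeMonoid

-- Partial averages as counts.

-- A counterpart of `Matches?` that takes a subset and a reference vertex, and so unfolds coordinate
-- by coordinate exactly like `M`.
agree : ∀ {n} {qs : Vec ℕ n} → Subset n → Vertex qs → Vertex qs → Bool
agree []            []      []      = true
agree (outside ∷ T) (a ∷ x) (b ∷ y) = agree T x y
agree (inside  ∷ T) (a ∷ x) (b ∷ y) = does (a ≟ b) ∧ agree T x y

agree⇒at≡ : ∀ {n} {qs : Vec ℕ n} T (x y : Vertex qs) → agree T x y ≡ true →
            ∀ {k} → k ∈ T → x at k ≡ y at k
agree⇒at≡ (outside ∷ T) (a ∷ x) (b ∷ y) eq (there k∈T) = agree⇒at≡ T x y eq k∈T
agree⇒at≡ (inside ∷ T)  (a ∷ x) (b ∷ y) eq k∈T with a ≟ b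
agree⇒at≡ (inside ∷ T)  (a ∷ x) (b ∷ y) eq here        | yes a≡b = a≡b
agree⇒at≡ (inside ∷ T)  (a ∷ x) (b ∷ y) eq (there k∈T) | yes a≡b = agree⇒at≡ T x y eq k∈T

at≡⇒agree : ∀ {n} {qs : Vec ℕ n} T (x y : Vertex qs) → (∀ {k} → k ∈ T → x at k ≡ y at k) →
            agree T x y ≡ true
at≡⇒agree []            []      []      eq = refl
at≡⇒agree (outside ∷ T) (a ∷ x) (b ∷ y) eq = at≡⇒agree T x y (λ k∈T → eq (there k∈T))
at≡⇒agree (inside  ∷ T) (a ∷ x) (b ∷ y) eq =
  cong₂ _∧_ (dec-true (a ≟ b) (eq here)) (at≡⇒agree T x y (λ k∈T → eq (there k∈T)))

weight : ∀ {n} → Vec ℕ n → Subset n → ℕ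
weight qs T = ∏ (λ k → if lookup T k then lookup qs k else 1)

∑-agree : ∀ {n} {qs : Vec ℕ n} → Subset n → Vertex qs → (Vertex qs → ℚ) → ℚ
∑-agree T x f = ∑Vℚ (λ y → if agree T x y then f y else 0ℚ)

-- `M T f x` averages `f` over the vertices agreeing with `x` on `T`, whose number is |V| divided by
-- `weight qs T`.
M-agree : ∀ {n} {qs : Vec ℕ n} T f (x : Vertex qs) →
          M T f x ≡ invs qs * (fromℕ (weight qs T) * ∑-agree T x f)
M-agree []            f []      = units (f [])
  where
  units : ∀ x → x ≡ 1ℚ * (1ℚ * x)
  units = solve-∀ ring
M-agree {qs = q ∷ qs} (outside ∷ T) f (a ∷ x) = begin
  M T (E f) x
    ≡⟨ M-agree T (E f) x ⟩
  invs qs * (fromℕ (weight qs T) * ∑-agree T x (E f))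
    ≡⟨ cong (λ r → invs qs * (fromℕ (weight qs T) * r)) (E-commutes lin f) ⟨
  invs qs * (fromℕ (weight qs T) * (inv q * ∑-agree (outside ∷ T) (a ∷ x) f))
    ≡⟨ shuffle (invs qs) (fromℕ (weight qs T)) (inv q) (∑-agree (outside ∷ T) (a ∷ x) f) ⟩
  inv q * invs qs * (fromℕ (weight qs T) * ∑-agree (outside ∷ T) (a ∷ x) f)
    ≡⟨ cong (λ w → inv q * invs qs * (w * ∑-agree (outside ∷ T) (a ∷ x) f))
         (cong fromℕ (ℕ.*-identityˡ (weight qs T))) ⟨
  inv q * invs qs * (fromℕ (weight (q ∷ qs) (outside ∷ T)) * ∑-agree (outside ∷ T) (a ∷ x) f) ∎
  where
  open ≡-Reasoning
  lin : Linear (∑-agree T x)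
  lin = ∘-linear ∑Vℚ.linear (λ y → if-linear (agree T x y) y)
  shuffle : ∀ x y z w → x * (y * (z * w)) ≡ z * x * (y * w)
  shuffle = solve-∀ ring
M-agree {qs = q@(suc m) ∷ qs} (inside ∷ T) f (a ∷ x) = begin
  M T (λ y → f (a ∷ y)) x
    ≡⟨ M-agree T (λ y → f (a ∷ y)) x ⟩
  invs qs * (fromℕ (weight qs T) * ∑-agree T x (λ y → f (a ∷ y)))
    ≡⟨ cong (λ r → invs qs * (fromℕ (weight qs T) * r)) (∑ℚ-δ a (λ b → ∑-agree T x (λ y → f (b ∷ y)))) ⟨
  invs qs * (fromℕ (weight qs T) * ∑ℚ (λ b → if does (a ≟ b) then ∑-agree T x (λ y → f (b ∷ y)) else 0ℚ))
    ≡⟨ cong (λ r → invs qs * (fromℕ (weight qs T) * r)) (∑ℚ.J-cong pull) ⟩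
  invs qs * (fromℕ (weight qs T) * ∑-agree (inside ∷ T) (a ∷ x) f)
    -- The inserted 1 is `fromℕ q * inv q`: its two factors become the new entries of `weight` and
    -- `invs`.
    ≡⟨ *-identityˡ _ ⟨
  1ℚ * (invs qs * (fromℕ (weight qs T) * ∑-agree (inside ∷ T) (a ∷ x) f))
    ≡⟨ cong (_* (invs qs * (fromℕ (weight qs T) * ∑-agree (inside ∷ T) (a ∷ x) f))) (*-inv m) ⟨
  fromℕ q * inv q * (invs qs * (fromℕ (weight qs T) * ∑-agree (inside ∷ T) (a ∷ x) f))
    ≡⟨ shuffle (fromℕ q) (inv q) (invs qs) (fromℕ (weight qs T)) (∑-agree (inside ∷ T) (a ∷ x) f) ⟩
  inv q * invs qs * (fromℕ q * fromℕ (weight qs T) * ∑-agree (inside ∷ T) (a ∷ x) f)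
    ≡⟨ cong (λ w → inv q * invs qs * (w * ∑-agree (inside ∷ T) (a ∷ x) f)) (fromℕ-* q (weight qs T)) ⟨
  inv q * invs qs * (fromℕ (weight (q ∷ qs) (inside ∷ T)) * ∑-agree (inside ∷ T) (a ∷ x) f) ∎
  where
  open ≡-Reasoning
  shuffle : ∀ p x y z w → p * x * (y * (z * w)) ≡ x * y * (p * z * w)
  shuffle = solve-∀ ring
  pull : ∀ b → (if does (a ≟ b) then ∑-agree T x (λ y → f (b ∷ y)) else 0ℚ) ≡
               ∑Vℚ (λ y → if does (a ≟ b) ∧ agree T x y then f (b ∷ y) else 0ℚ)
  pull b with a ≟ b
  ... | yes _ = refl
  ... | no  _ = sym (∑Vℚ.J-0 {qs = qs} (λ _ → refl))

image : ∀ {t n} → (Fin t → Fin n) → Subset n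
image i = tabulate (λ k → does (any? (λ j → i j ≟ k)))

lookup-image : ∀ {t n} (i : Fin t → Fin n) k → lookup (image i) k ≡ does (any? (λ j → i j ≟ k))
lookup-image i = lookup∘tabulate (λ k → does (any? (λ j → i j ≟ k)))

∈-image⁺ : ∀ {t n} (i : Fin t → Fin n) j → i j ∈ image i
∈-image⁺ i j = lookup⇒[]= (i j) (image i)
  (trans (lookup-image i (i j)) (dec-true (any? (λ j′ → i j′ ≟ i j)) (j , refl)))

∈-image⁻ : ∀ {t n} (i : Fin t → Fin n) {k} → k ∈ image i → ∃ λ j → i j ≡ k
∈-image⁻ i {k} k∈T with any? (λ j → i j ≟ k) | trans (sym (lookup-image i k)) ([]=⇒lookup k∈T)
... | yes found | _ = found

∏-image : ∀ {t n} (i : Fin t → Fin n) → Injective _≡_ _≡_ i → ∀ (qs : Vec ℕ n) →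
          ∏ (λ j → lookup qs (i j)) ≡ weight qs (image i)
∏-image i inj qs = trans (sum-image ℕ.*-1-commutativeMonoid i inj (lookup qs))
  (MonoidSum.sum-cong-≗ ℕ.*-1-commutativeMonoid
    (λ k → cong (λ b → if b then lookup qs k else 1) (sym (lookup-image i k))))

∣S∣≡∑ : ∀ {n} (S : Subset n) → ∣ S ∣ ≡ ∑ (λ k → if lookup S k then 1 else 0)
∣S∣≡∑ []            = refl
∣S∣≡∑ (outside ∷ S) = ∣S∣≡∑ S
∣S∣≡∑ (inside  ∷ S) = cong suc (∣S∣≡∑ S)

∑-1 : ∀ t → ∑ {t} (λ _ → 1) ≡ t
∑-1 zero    = refl
∑-1 (suc t) = cong suc (∑-1 t)

∣image∣ : ∀ {t n} (i : Fin t → Fin n) → Injective _≡_ _≡_ i → ∣ image i ∣ ≡ t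
∣image∣ {t} i inj = begin
  ∣ image i ∣
    ≡⟨ ∣S∣≡∑ (image i) ⟩
  ∑ (λ k → if lookup (image i) k then 1 else 0)
    ≡⟨ MonoidSum.sum-cong-≗ ℕ.+-0-commutativeMonoid (λ k → cong (λ b → if b then 1 else 0) (lookup-image i k)) ⟩
  ∑ (λ k → if does (any? (λ j → i j ≟ k)) then 1 else 0)
    ≡⟨ sum-image ℕ.+-0-commutativeMonoid i inj (λ _ → 1) ⟨
  ∑ {t} (λ _ → 1)
    ≡⟨ ∑-1 t ⟩
  t ∎
  where open ≡-Reasoning

-- Strength speaks of exactly `t` distinct positions; padding `S` to `t` positions makes it usable
-- for smaller sets.
injection-onto : ∀ {n} (S : Subset n) {t} → ∣ S ∣ ℕ.≤ t → t ℕ.≤ n →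
                 ∃ λ (i : Fin t → Fin n) → Injective _≡_ _≡_ i × (∀ {k} → k ∈ S → ∃ λ j → i j ≡ k)
injection-onto [] {zero} _ _ = (λ ()) , (λ {}) , λ ()
injection-onto (inside ∷ S) {suc t} (s≤s ∣S∣≤t) (s≤s t≤n)
  with i , inj , onto ← injection-onto S ∣S∣≤t t≤n = i′ , inj′ , onto′
  where
  i′ : Fin (suc t) → Fin _
  i′ zero    = zero
  i′ (suc j) = suc (i j)
  inj′ : Injective _≡_ _≡_ i′
  inj′ {zero}  {zero}  _  = refl
  inj′ {suc _} {suc _} eq = cong suc (inj (suc-injective eq))
  onto′ : ∀ {k} → k ∈ inside ∷ S → ∃ λ j → i′ j ≡ k
  onto′ here = zero , refl
  onto′ (there k∈S) with j , eq ← onto k∈S = suc j , cong suc eq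
injection-onto {suc n} (outside ∷ S) {t} ∣S∣≤t t≤1+n with ℕ.m≤n⇒m<n∨m≡n t≤1+n
-- As many positions as there are coordinates: all are taken. Otherwise the first coordinate can be
-- skipped.
... | inj₂ refl = (λ j → j) , (λ eq → eq) , λ {k} _ → k , refl
... | inj₁ (s≤s t≤n) with i , inj , onto ← injection-onto S ∣S∣≤t t≤n =
  suc ∘ i , inj ∘ suc-injective , λ { (there k∈S) → let j , eq = onto k∈S in j , cong suc eq }

at-lookup⁻ : ∀ {n} {qs : Vec ℕ n} (g : ∀ k → Fin (lookup qs k)) k → _at_ {qs = qs} (lookup⁻ g) k ≡ g k
at-lookup⁻ {qs = _ ∷ _} g zero    = refl
at-lookup⁻ {qs = _ ∷ qs} g (suc k) = at-lookup⁻ {qs = qs} (λ k → g (suc k)) k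

-- Injectivity makes the prescribed values consistent: the index found by the search is the one that
-- was meant. Positions off the image get the `default`.
extend : ∀ {t n} {qs : Vec ℕ n} → (∀ k → Fin (lookup qs k)) →
         (i : Fin t → Fin n) → Injective _≡_ _≡_ i → (a : ∀ j → Fin (lookup qs (i j))) →
         ∃ λ (x : Vertex qs) → ∀ j → x at i j ≡ a j
extend {qs = qs} default i inj a =
  lookup⁻ g , λ j → trans (at-lookup⁻ {qs = qs} g (i j)) (pick-eq (any? (λ j′ → i j′ ≟ i j)) refl)
  where
  pick : ∀ k → Dec (∃ λ j → i j ≡ k) → Fin (lookup qs k)
  pick k (yes (j , refl)) = a j
  pick k (no _)           = default k

  g : ∀ k → Fin (lookup qs k)
  g k = pick k (any? (λ j → i j ≟ k))

  pick-eq : ∀ {k j} (found : Dec (∃ λ j → i j ≡ k)) (eq : i j ≡ k) →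
            pick k found ≡ subst (λ k → Fin (lookup qs k)) eq (a j)
  pick-eq {j = j} (yes (j′ , refl)) eq with inj eq
  pick-eq (yes (j , refl)) refl | refl = refl
  pick-eq (no none) eq = contradiction (_ , eq) none

⟦_⟧ : ∀ {n} {qs : Vec ℕ n} → Multiset qs → Vertex qs → ℚ
⟦ C ⟧ x = fromℕ (C x)

module _ {n} {qs : Vec ℕ n} (C : Multiset qs) where

  count-agree : ∀ {t} (i : Fin t → Fin n) (a : ∀ j → Fin (lookup qs (i j))) (x : Vertex qs) →
                (∀ j → x at i j ≡ a j) →
                fromℕ (count (Matches? i a) C) ≡ ∑-agree (image i) x ⟦ C ⟧
  count-agree i a x x≡a = trans
    (fromℕ-∑V (λ y → if does (Matches? i a y) then C y else 0))
    (∑Vℚ.J-cong same)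
    where
    x≡y : ∀ y → Matches i a y → ∀ {k} → ∃ (λ j → i j ≡ k) → x at k ≡ y at k
    x≡y y y≡a (j , refl) = trans (x≡a j) (sym (y≡a j))

    same : ∀ y → fromℕ (if does (Matches? i a y) then C y else 0) ≡
                 (if agree (image i) x y then ⟦ C ⟧ y else 0ℚ)
    same y = trans
      (fromℕ-if (does (Matches? i a y)) (C y))
      (cong (λ b → if b then ⟦ C ⟧ y else 0ℚ) (does-≡ (Matches? i a y)
        (λ y≡a → at≡⇒agree (image i) x y (λ k∈T → x≡y y y≡a (∈-image⁻ i k∈T)))
        (λ agrees j → trans (sym (agree⇒at≡ (image i) x y agrees (∈-image⁺ i j))) (x≡a j))))

  -- Up to the factor 1/|V|, the average is the left side of `IsOA.strength`; this is the link
  -- between arrays and components.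
  M-count : ∀ {t} (i : Fin t → Fin n) → Injective _≡_ _≡_ i →
            (a : ∀ j → Fin (lookup qs (i j))) (x : Vertex qs) → (∀ j → x at i j ≡ a j) →
            M (image i) ⟦ C ⟧ x ≡
            invs qs * fromℕ (count (Matches? i a) C ℕ.* ∏ (λ j → lookup qs (i j)))
  M-count i inj a x x≡a = begin
    M (image i) ⟦ C ⟧ x
      ≡⟨ M-agree (image i) ⟦ C ⟧ x ⟩
    invs qs * (fromℕ (weight qs (image i)) * ∑-agree (image i) x ⟦ C ⟧)
      ≡⟨ cong (invs qs *_) (cong₂ _*_ (cong fromℕ (∏-image i inj qs)) (count-agree i a x x≡a)) ⟨
    invs qs * (fromℕ (∏ (λ j → lookup qs (i j))) * fromℕ (count (Matches? i a) C))
      ≡⟨ cong (invs qs *_) (*-comm (fromℕ (∏ (λ j → lookup qs (i j)))) (fromℕ (count (Matches? i a) C))) ⟩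
    invs qs * (fromℕ (count (Matches? i a) C) * fromℕ (∏ (λ j → lookup qs (i j))))
      ≡⟨ cong (invs qs *_) (fromℕ-* (count (Matches? i a) C) (∏ (λ j → lookup qs (i j)))) ⟨
    invs qs * fromℕ (count (Matches? i a) C ℕ.* ∏ (λ j → lookup qs (i j))) ∎
    where open ≡-Reasoning

-- Strength as vanishing of components.

NoComponents : ∀ {n} {qs : Vec ℕ n} → ℕ → (Vertex qs → ℚ) → Set
NoComponents t f = ∀ S → 0 ℕ.< ∣ S ∣ → ∣ S ∣ ℕ.≤ t → ∀ x → P S f x ≡ 0ℚ

module _ {n} {qs : Vec ℕ n} {C : Multiset qs} {t : ℕ} where

  -- Enlarge `S` to the image of `t` positions. Strength makes the average over the other
  -- coordinates constant, `P S` does not notice this averaging, and it annihilates constants.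
  OA⇒NoComponents : ∀ {N} → t ℕ.≤ n → IsOA N t C → NoComponents t ⟦ C ⟧
  OA⇒NoComponents t≤n oa S 0<∣S∣ ∣S∣≤t x
    with i , inj , onto ← injection-onto S ∣S∣≤t t≤n = begin
    P S ⟦ C ⟧ x                                ≡⟨ P-M-⊆ S (image i) S⊆image ⟦ C ⟧ x ⟨
    P S (M (image i) ⟦ C ⟧) x                  ≡⟨ J-cong (P-linear S x) M-constant ⟩
    P S (λ _ → invs qs * fromℕ (card C)) x       ≡⟨ P-const S 0<∣S∣ (invs qs * fromℕ (card C)) x ⟩
    0ℚ                                           ∎
    where
    open ≡-Reasoning
    S⊆image : S ⊆ image i
    S⊆image k∈S with j , refl ← onto k∈S = ∈-image⁺ i j
    M-constant : ∀ y → M (image i) ⟦ C ⟧ y ≡ invs qs * fromℕ (card C)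
    -- The prescribed values are those of `y` itself.
    M-constant y = trans (M-count C i inj (λ j → y at i j) y (λ _ → refl))
      (cong (λ m → invs qs * fromℕ m) (IsOA.strength oa i inj (λ j → y at i j)))

  -- Decompose the average: components not inside `T` are averaged away, nonempty ones inside `T`
  -- vanish by hypothesis, and only the mean remains.
  NoComponents⇒M : NoComponents t ⟦ C ⟧ → ∀ T → ∣ T ∣ ℕ.≤ t → ∀ x →
                   M T ⟦ C ⟧ x ≡ invs qs * fromℕ (card C)
  NoComponents⇒M none T ∣T∣≤t x = begin
    M T ⟦ C ⟧ x                       ≡⟨ ∑S-P (M T ⟦ C ⟧) x ⟨
    ∑S (λ S → P S (M T ⟦ C ⟧) x)      ≡⟨ ∑S-⊥ (λ S → P S (M T ⟦ C ⟧) x) vanish ⟩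
    P ⊥ (M T ⟦ C ⟧) x                 ≡⟨ P-M-⊆ ⊥ T ⊥⊆ ⟦ C ⟧ x ⟩
    P ⊥ ⟦ C ⟧ x                       ≡⟨ P-⊥ ⟦ C ⟧ x ⟩
    invs qs * ∑Vℚ ⟦ C ⟧               ≡⟨ cong (invs qs *_) (fromℕ-∑V C) ⟨
    invs qs * fromℕ (card C)            ∎
    where
    open ≡-Reasoning
    vanish : ∀ S → 0 ℕ.< ∣ S ∣ → P S (M T ⟦ C ⟧) x ≡ 0ℚ
    vanish S 0<∣S∣ with S ⊆? T
    ... | yes S⊆T = trans (P-M-⊆ S T S⊆T ⟦ C ⟧ x)
                          (none S 0<∣S∣ (ℕ.≤-trans (p⊆q⇒∣p∣≤∣q∣ S⊆T) ∣T∣≤t) x)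
    ... | no  S⊈T = P-M-⊈ S T S⊈T ⟦ C ⟧ x

∏*invs : ∀ {n} (qs : Vec ℕ n) → (∀ k → Fin (lookup qs k)) → fromℕ (∏ (lookup qs)) * invs qs ≡ 1ℚ
∏*invs []               _ = refl
∏*invs (zero ∷ qs)      a with () ← a zero
∏*invs (q@(suc m) ∷ qs) a = begin
  fromℕ (∏ (lookup (q ∷ qs))) * (inv q * invs qs)        ≡⟨ cong (_* (inv q * invs qs)) (fromℕ-* q (∏ (lookup qs))) ⟩
  fromℕ q * fromℕ (∏ (lookup qs)) * (inv q * invs qs)    ≡⟨ shuffle (fromℕ q) (fromℕ (∏ (lookup qs))) (inv q) (invs qs) ⟩
  fromℕ q * inv q * (fromℕ (∏ (lookup qs)) * invs qs)    ≡⟨ cong₂ _*_ (*-inv m) (∏*invs qs (λ k → a (suc k))) ⟩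
  1ℚ * 1ℚ                                                ≡⟨⟩
  1ℚ                                                     ∎
  where
  open ≡-Reasoning
  shuffle : ∀ x y z w → x * y * (z * w) ≡ x * z * (y * w)
  shuffle = solve-∀ ring

-- `M-count` and `NoComponents⇒M` evaluate the same average. Multiplying by |V| removes `invs qs`,
-- and the equality descends to ℕ.
NoComponents⇒OA : ∀ {n} {qs : Vec ℕ n} {C : Multiset qs} {t} → (∀ k → Fin (lookup qs k)) →
                  0 ℕ.< card C → NoComponents t ⟦ C ⟧ → IsOA (card C) t C
NoComponents⇒OA {qs = qs} {C} default 0<card none = record
  { size     = refl
  ; nonempty = 0<card
  ; strength = λ i inj a → let x , x≡a = extend default i inj a in
      fromℕ-injective (cancel-invs (trans
        (sym (M-count C i inj a x x≡a))
        (NoComponents⇒M {C = C} none (image i) (ℕ.≤-reflexive (∣image∣ i inj)) x)))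
  }
  where
  V : ℚ
  V = fromℕ (∏ (lookup qs))
  scale : ∀ p → V * (invs qs * p) ≡ p
  scale p = trans (sym (*-assoc V (invs qs) p)) (trans (cong (_* p) (∏*invs qs default)) (*-identityˡ p))
  cancel-invs : ∀ {p r} → invs qs * p ≡ invs qs * r → p ≡ r
  cancel-invs {p} {r} eq = trans (sym (scale p)) (trans (cong (V *_) eq) (scale r))

-- The adjacency operator of H.

δ : ∀ {n} {qs : Vec ℕ n} → Vertex qs → Vertex qs → ℚ
δ []      []      = 1ℚ
δ (a ∷ x) (b ∷ y) = if does (a ≟ b) then δ x y else 0ℚ

δ-≡ : ∀ {n} {qs : Vec ℕ n} (x y : Vertex qs) → (∀ i → x at i ≡ y at i) → δ x y ≡ 1ℚ
δ-≡ []      []      eq = refl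
δ-≡ (a ∷ x) (b ∷ y) eq with a ≟ b
... | yes _   = δ-≡ x y (λ i → eq (suc i))
... | no  a≢b = contradiction (eq zero) a≢b

δ-cases : ∀ {n} {qs : Vec ℕ n} (x y : Vertex qs) → δ x y ≡ 0ℚ ⊎ (∀ i → x at i ≡ y at i)
δ-cases []      []      = inj₂ λ ()
δ-cases (a ∷ x) (b ∷ y) with a ≟ b
... | no _    = inj₁ refl
... | yes a≡b with δ-cases x y
...   | inj₁ δ≡0 = inj₁ δ≡0
...   | inj₂ x≡y = inj₂ λ { zero → a≡b ; (suc i) → x≡y i }

∑Vℚ-δ : ∀ {n} {qs : Vec ℕ n} (x : Vertex qs) f → ∑Vℚ (λ y → δ x y * f y) ≡ f x
∑Vℚ-δ []      f = *-identityˡ (f [])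
∑Vℚ-δ {qs = q ∷ qs} (a ∷ x) f = trans (∑ℚ.J-cong row) (∑ℚ-δ a (λ b → f (b ∷ x)))
  where
  row : ∀ b → ∑Vℚ (λ y → δ (a ∷ x) (b ∷ y) * f (b ∷ y)) ≡ (if does (a ≟ b) then f (b ∷ x) else 0ℚ)
  row b with a ≟ b
  ... | yes _ = ∑Vℚ-δ x (λ y → f (b ∷ y))
  ... | no  _ = ∑Vℚ.J-0 (λ y → *-zeroˡ (f (b ∷ y)))

-- The matrix of edge multiplicities by recursion: if the heads agree, the difference must lie in
-- the tails; if they differ, the tails must coincide and the multiplicity is Q/q.
adj : ∀ {n} {qs : Vec ℕ n} → ℚ → Vertex qs → Vertex qs → ℚ
adj Q []                []      = 0ℚ
adj {qs = q ∷ _} Q (a ∷ x) (b ∷ y) = if does (a ≟ b) then adj Q x y else Q * inv q * δ x y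

adj-differ : ∀ {n} {qs : Vec ℕ n} Q (x y : Vertex qs) i → DifferOnlyAt x y i →
             adj Q x y ≡ Q * inv (lookup qs i)
adj-differ {qs = q ∷ _} Q (a ∷ x) (b ∷ y) zero (a≢b , same) with a ≟ b
... | yes a≡b = contradiction a≡b a≢b
... | no  _   = trans (cong (Q * inv q *_) (δ-≡ x y (λ j → same (suc j) λ ()))) (*-identityʳ (Q * inv q))
adj-differ Q (a ∷ x) (b ∷ y) (suc i) (x≢y , same) with a ≟ b
... | yes _   = adj-differ Q x y i (x≢y , λ j j≢i → same (suc j) (λ { refl → j≢i refl }))
... | no  a≢b = contradiction (same zero λ ()) a≢b

adj-none : ∀ {n} {qs : Vec ℕ n} Q (x y : Vertex qs) → (∀ i → ¬ DifferOnlyAt x y i) → adj Q x y ≡ 0ℚ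
adj-none Q []      []      none = refl
adj-none {qs = q ∷ _} Q (a ∷ x) (b ∷ y) none with a ≟ b
... | yes a≡b = adj-none Q x y λ { i (x≢y , same) →
  none (suc i) (x≢y , λ { zero _ → a≡b ; (suc j) j≢i → same j (λ { refl → j≢i refl }) }) }
... | no  a≢b with δ-cases x y
...   | inj₁ δ≡0 = trans (cong (Q * inv q *_) δ≡0) (*-zeroʳ (Q * inv q))
...   | inj₂ x≡y = contradiction (a≢b , λ { zero 0≢0 → contradiction refl 0≢0 ; (suc j) _ → x≡y j }) (none zero)

-- In direction i a vertex has q_i - 1 neighbours of multiplicity Q/q_i, which gives Q(1 - 1/q_i);
-- this is the sum over i.
degree : ∀ {n} → ℚ → Vec ℕ n → ℚ
degree {n} Q qs = Q * (fromℕ n - ∑ℚ (λ i → inv (lookup qs i)))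

-- Direction i contributes Q/q_i times the line sum without the vertex itself, that is, Q E_i f -
-- (Q/q_i) f = Q(1 - 1/q_i) f - Q(f - E_i f).
∑Vℚ-adj : ∀ {n} {qs : Vec ℕ n} Q (x : Vertex qs) f →
          ∑Vℚ (λ y → adj Q x y * f y) ≡ degree Q qs * f x - Q * L f x
∑Vℚ-adj Q [] f = zeros Q (f [])
  where
  zeros : ∀ x y → 0ℚ * y ≡ x * (0ℚ - 0ℚ) * y - x * 0ℚ
  zeros = solve-∀ ring
∑Vℚ-adj {suc n} {qs = q ∷ qs} Q (a ∷ x) f = begin
  ∑ℚ (λ b → ∑Vℚ (λ y → adj Q (a ∷ x) (b ∷ y) * f (b ∷ y)))
    -- The generic term is used for all `b`, including `b = a`, with a correction supported at `a`
    -- alone that `∑ℚ-δ` evaluates.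
    ≡⟨ ∑ℚ.J-cong row ⟩
  ∑ℚ (λ b → w * f (b ∷ x) + (if does (a ≟ b) then X b - w * f (b ∷ x) else 0ℚ))
    ≡⟨ ∑ℚ.J-+ (λ b → w * f (b ∷ x)) (λ b → if does (a ≟ b) then X b - w * f (b ∷ x) else 0ℚ) ⟩
  ∑ℚ (λ b → w * f (b ∷ x)) + ∑ℚ (λ b → if does (a ≟ b) then X b - w * f (b ∷ x) else 0ℚ)
    ≡⟨ cong₂ _+_ (∑ℚ.J-* w (λ b → f (b ∷ x))) (∑ℚ-δ a (λ b → X b - w * f (b ∷ x))) ⟩
  w * s + (X a - w * f (a ∷ x))
    ≡⟨ cong (λ r → w * s + (r - w * f (a ∷ x))) (∑Vℚ-adj Q x (λ y → f (a ∷ y))) ⟩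
  w * s + (degree Q qs * f (a ∷ x) - Q * L (λ y → f (a ∷ y)) x - w * f (a ∷ x))
    ≡⟨ collect Q (inv q) s (fromℕ n) (∑ℚ (λ i → inv (lookup qs i))) (f (a ∷ x)) (L (λ y → f (a ∷ y)) x) ⟩
  Q * ((1ℚ + fromℕ n) - (inv q + ∑ℚ (λ i → inv (lookup qs i)))) * f (a ∷ x) -
  Q * L f (a ∷ x)
    ≡⟨ cong (λ r → Q * (r - (inv q + ∑ℚ (λ i → inv (lookup qs i)))) * f (a ∷ x) - Q * L f (a ∷ x)) (fromℕ-+ 1 n) ⟨
  degree Q (q ∷ qs) * f (a ∷ x) - Q * L f (a ∷ x) ∎
  where
  open ≡-Reasoning
  w = Q * inv q
  s = ∑ℚ (λ b → f (b ∷ x))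
  X : Fin q → ℚ
  X b = ∑Vℚ (λ y → adj Q x y * f (b ∷ y))
  cancel : ∀ x y → x ≡ y + (x - y)
  cancel = solve-∀ ring
  collect : ∀ Q i s n d u l → Q * i * s + (Q * (n - d) * u - Q * l - Q * i * u) ≡
                              Q * ((1ℚ + n) - (i + d)) * u - Q * ((u - i * s) + l)
  collect = solve-∀ ring
  row : ∀ b → ∑Vℚ (λ y → adj Q (a ∷ x) (b ∷ y) * f (b ∷ y)) ≡
              w * f (b ∷ x) + (if does (a ≟ b) then X b - w * f (b ∷ x) else 0ℚ)
  row b with a ≟ b
  ... | yes _ = cancel (X b) (w * f (b ∷ x))
  ... | no  _ = begin
    ∑Vℚ (λ y → w * δ x y * f (b ∷ y))      ≡⟨ ∑Vℚ.J-cong (λ y → *-assoc w (δ x y) (f (b ∷ y))) ⟩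
    ∑Vℚ (λ y → w * (δ x y * f (b ∷ y)))    ≡⟨ ∑Vℚ.J-* w (λ y → δ x y * f (b ∷ y)) ⟩
    w * ∑Vℚ (λ y → δ x y * f (b ∷ y))      ≡⟨ cong (w *_) (∑Vℚ-δ x (λ y → f (b ∷ y))) ⟩
    w * f (b ∷ x)                          ≡⟨ +-identityʳ (w * f (b ∷ x)) ⟨
    w * f (b ∷ x) + 0ℚ                     ∎

lookup∣lcms : ∀ {n} (qs : Vec ℕ n) i → lookup qs i ∣ lcms qs
lookup∣lcms (q ∷ qs) zero    = ℕ.m∣lcm[m,n] q (lcms qs)
lookup∣lcms (q ∷ qs) (suc i) = ∣-trans (lookup∣lcms qs i) (ℕ.n∣lcm[m,n] q (lcms qs))

fromℕ-/ : ∀ m d .{{_ : ℕ.NonZero d}} → d ∣ m → fromℕ (m ℕ./ d) ≡ fromℕ m * inv d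
fromℕ-/ m d@(suc d′) d∣m = begin
  fromℕ (m ℕ./ d)                          ≡⟨ *-identityʳ (fromℕ (m ℕ./ d)) ⟨
  fromℕ (m ℕ./ d) * 1ℚ                     ≡⟨ cong (fromℕ (m ℕ./ d) *_) (*-inv d′) ⟨
  fromℕ (m ℕ./ d) * (fromℕ d * inv d)      ≡⟨ *-assoc (fromℕ (m ℕ./ d)) (fromℕ d) (inv d) ⟨
  fromℕ (m ℕ./ d) * fromℕ d * inv d        ≡⟨ cong (_* inv d) (fromℕ-* (m ℕ./ d) d) ⟨
  fromℕ (m ℕ./ d ℕ.* d) * inv d            ≡⟨ cong (λ r → fromℕ r * inv d) (ℕ.m/n*n≡m d∣m) ⟩
  fromℕ m * inv d                          ∎
  where open ≡-Reasoning

module _ {n} (qs : Vec ℕ n) (qs≥2 : ∀ i → 2 ℕ.≤ lookup qs i) where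

  private
    Q k : ℚ
    Q = fromℕ (lcms qs)
    k = degree Q qs

  fromℕ-edges : ∀ x y → fromℕ (edges qs qs≥2 x y) ≡ adj Q x y
  fromℕ-edges x y with any? (DifferOnlyAt? x y)
  ... | yes (i , differ) = trans
    (fromℕ-/ (lcms qs) (lookup qs i) {{ℕ.>-nonZero (ℕ.<⇒≤ (qs≥2 i))}} (lookup∣lcms qs i))
    (sym (adj-differ Q x y i differ))
  ... | no none = sym (adj-none Q x y (λ i differ → none (i , differ)))

  ∑Vℚ-edges : ∀ x f → ∑Vℚ (λ y → fromℕ (edges qs qs≥2 x y) * f y) ≡ k * f x - Q * L f x
  ∑Vℚ-edges x f = trans (∑Vℚ.J-cong (λ y → cong (_* f y) (fromℕ-edges x y))) (∑Vℚ-adj Q x f)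

  module _ {C : Multiset qs} (simple : Simple C) where

    -- For a simple multiset the multiplicity function is the indicator of the support, so counting
    -- edges is applying the adjacency operator to it; for the complement, to `1ℚ - ⟦ C ⟧`.
    edgesTo-Support : ∀ x → fromℕ (edgesTo qs qs≥2 (Support? C) x) ≡ k * ⟦ C ⟧ x - Q * L ⟦ C ⟧ x
    edgesTo-Support x = trans
      (fromℕ-∑V (λ y → if does (Support? C y) then edges qs qs≥2 x y else 0))
      (trans (∑Vℚ.J-cong (λ y → indicator (edges qs qs≥2 x y) (simple y))) (∑Vℚ-edges x ⟦ C ⟧))
      where
      indicator : ∀ e {m} → m ℕ.≤ 1 → fromℕ (if does (0 ℕ.<? m) then e else 0) ≡ fromℕ e * fromℕ m
      indicator e z≤n       = sym (*-zeroʳ (fromℕ e))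
      indicator e (s≤s z≤n) = sym (*-identityʳ (fromℕ e))

    edgesTo-∁Support : ∀ x → fromℕ (edgesTo qs qs≥2 (∁? (Support? C)) x) ≡
                             k * (1ℚ - ⟦ C ⟧ x) - Q * L (λ y → 1ℚ - ⟦ C ⟧ y) x
    edgesTo-∁Support x = trans
      (fromℕ-∑V (λ y → if does (∁? (Support? C) y) then edges qs qs≥2 x y else 0))
      (trans (∑Vℚ.J-cong (λ y → indicator (edges qs qs≥2 x y) (simple y))) (∑Vℚ-edges x (λ y → 1ℚ - ⟦ C ⟧ y)))
      where
      indicator : ∀ e {m} → m ℕ.≤ 1 →
                  fromℕ (if not (does (0 ℕ.<? m)) then e else 0) ≡ fromℕ e * (1ℚ - fromℕ m)
      indicator e z≤n       = sym (*-identityʳ (fromℕ e))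
      indicator e (s≤s z≤n) = sym (*-zeroʳ (fromℕ e))

-- The residual and its nonnegative pairing with f.

P-⊥-const : ∀ {n} {qs : Vec ℕ n} c (x : Vertex qs) → P ⊥ (λ _ → c) x ≡ c
P-⊥-const c []      = refl
P-⊥-const c (a ∷ x) = trans (J-cong (P-linear ⊥ x) (λ _ → E-const a c)) (P-⊥-const c x)

L-const : ∀ {n} {qs : Vec ℕ n} c (x : Vertex qs) → L (λ _ → c) x ≡ 0ℚ
L-const c []      = refl
L-const c (a ∷ x) = cong₂ _+_ (trans (cong (λ r → c - r) (E-const a c)) (+-inverseʳ c)) (L-const c x)

∣S∣≡0⇒S≡⊥ : ∀ {n} (S : Subset n) → ∣ S ∣ ≡ 0 → S ≡ ⊥
∣S∣≡0⇒S≡⊥ []            _  = refl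
∣S∣≡0⇒S≡⊥ (outside ∷ S) eq = cong (outside ∷_) (∣S∣≡0⇒S≡⊥ S eq)

module Residual {n} {qs : Vec ℕ n} (t : ℕ) (f : Vertex qs → ℚ) where

  private
    T mean : ℚ
    T    = fromℕ (suc t)
    mean = invs qs * ∑Vℚ f

  -- The constant `T * mean` is chosen to cancel the component at `⊥`.
  residual : Vertex qs → ℚ
  residual x = (L f x - T * f x) + T * mean

  P-residual : ∀ S x → P S residual x ≡ (fromℕ ∣ S ∣ - T) * P S f x + P S (λ _ → T * mean) x
  P-residual S x = begin
    P S residual x
      ≡⟨ J-+ lin (λ y → L f y - T * f y) (λ _ → T * mean) ⟩
    P S (λ y → L f y - T * f y) x + P S (λ _ → T * mean) x
      ≡⟨ cong (_+ P S (λ _ → T * mean) x) (J-minus lin (L f) (λ y → T * f y)) ⟩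
    P S (L f) x - P S (λ y → T * f y) x + P S (λ _ → T * mean) x
      ≡⟨ cong (_+ P S (λ _ → T * mean) x) (cong₂ _-_ (P-L S f x) (J-* lin T f)) ⟩
    fromℕ ∣ S ∣ * P S f x - T * P S f x + P S (λ _ → T * mean) x
      ≡⟨ cong (_+ P S (λ _ → T * mean) x) (factor (fromℕ ∣ S ∣) T (P S f x)) ⟩
    (fromℕ ∣ S ∣ - T) * P S f x + P S (λ _ → T * mean) x ∎
    where
    open ≡-Reasoning
    lin = P-linear S x
    factor : ∀ x y z → x * z - y * z ≡ (x - y) * z
    factor = solve-∀ ring

  module _ (none : NoComponents t f) where

    -- The multiplier is 0 for empty `S`, where the constant cancels, and 0 for 1 ≤ |S| ≤ t, where
    -- `f` has no component. Beyond that it is |S| - (t+1), which is nonnegative.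
    P-residual-scale : ∀ S → ∃ λ d → 0ℚ ≤ d × (∀ x → P S residual x ≡ d * P S f x)
    P-residual-scale S with ∣ S ∣ in ∣S∣≡s
    ... | zero rewrite ∣S∣≡0⇒S≡⊥ S ∣S∣≡s = 0ℚ , ≤-refl , λ x → begin
      P ⊥ residual x
        ≡⟨ P-residual ⊥ x ⟩
      (fromℕ ∣ ⊥ {n} ∣ - T) * P ⊥ f x + P ⊥ (λ _ → T * mean) x
        ≡⟨ cong₂ _+_ (cong₂ (λ s p → (fromℕ s - T) * p) (∣⊥∣≡0 n) (P-⊥ f x)) (P-⊥-const (T * mean) x) ⟩
      (0ℚ - T) * mean + T * mean
        ≡⟨ cancel T mean (P ⊥ f x) ⟩
      0ℚ * P ⊥ f x ∎
      where
      open ≡-Reasoning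
      cancel : ∀ x y z → (0ℚ - x) * y + x * y ≡ 0ℚ * z
      cancel = solve-∀ ring
    ... | suc s with suc s ℕ.≤? t
    ...   | yes s<t = 0ℚ , ≤-refl , λ x → begin
      P S residual x
        ≡⟨ P-residual S x ⟩
      (fromℕ ∣ S ∣ - T) * P S f x + P S (λ _ → T * mean) x
        ≡⟨ cong₂ _+_ (cong ((fromℕ ∣ S ∣ - T) *_) (none S 0<∣S∣ (subst (ℕ._≤ t) (sym ∣S∣≡s) s<t) x))
                     (P-const S 0<∣S∣ (T * mean) x) ⟩
      (fromℕ ∣ S ∣ - T) * 0ℚ + 0ℚ
        ≡⟨ zeros (fromℕ ∣ S ∣ - T) (P S f x) ⟩
      0ℚ * P S f x ∎
      where
      open ≡-Reasoning
      0<∣S∣ : 0 ℕ.< ∣ S ∣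
      0<∣S∣ = subst (0 ℕ.<_) (sym ∣S∣≡s) (s≤s z≤n)
      zeros : ∀ x y → x * 0ℚ + 0ℚ ≡ 0ℚ * y
      zeros = solve-∀ ring
    ...   | no s≮t = fromℕ (suc s) - T , 0≤d , λ x → begin
      P S residual x
        ≡⟨ P-residual S x ⟩
      (fromℕ ∣ S ∣ - T) * P S f x + P S (λ _ → T * mean) x
        ≡⟨ cong₂ _+_ (cong (λ r → (fromℕ r - T) * P S f x) ∣S∣≡s)
                     (P-const S (subst (0 ℕ.<_) (sym ∣S∣≡s) (s≤s z≤n)) (T * mean) x) ⟩
      (fromℕ (suc s) - T) * P S f x + 0ℚ
        ≡⟨ +-identityʳ ((fromℕ (suc s) - T) * P S f x) ⟩
      (fromℕ (suc s) - T) * P S f x ∎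
      where
      open ≡-Reasoning
      0≤d : 0ℚ ≤ fromℕ (suc s) - T
      0≤d = subst (_≤ fromℕ (suc s) - T) (+-inverseʳ T) (+-monoˡ-≤ (- T) (fromℕ-mono-≤ (ℕ.≰⇒> s≮t)))

    P-f*P-residual : ∀ S x → P S f x * P S residual x ≡ proj₁ (P-residual-scale S) * (P S f x * P S f x)
    P-f*P-residual S x with d , _ , eq ← P-residual-scale S =
      trans (cong (P S f x *_) (eq x)) (shuffle (P S f x) d)
      where
      shuffle : ∀ x y → x * (y * x) ≡ y * (x * x)
      shuffle = solve-∀ ring

    P-f*P-residual≥0 : ∀ S x → 0ℚ ≤ P S f x * P S residual x
    P-f*P-residual≥0 S x = subst (0ℚ ≤_) (sym (P-f*P-residual S x))
      (*-nonNeg (proj₁ (proj₂ (P-residual-scale S))) (0≤p*p (P S f x)))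

    -- By Parseval the pairing splits over the sets `S`, and each part is a nonnegative multiple of
    -- a sum of squares.
    f*residual≥0 : 0ℚ ≤ ∑Vℚ (λ x → f x * residual x)
    f*residual≥0 = subst (0ℚ ≤_) (parseval f residual)
      (∑S.nonNeg (λ S → ∑Vℚ.nonNeg (P-f*P-residual≥0 S)))

    -- All the nonnegative products vanish. Multiplying such a product by the multiplier `d` gives
    -- the square of the component of the residual, so the case `d = 0` (for instance |S| = t+1)
    -- takes no separate argument.
    f*residual≡0⇒residual≡0 : ∑Vℚ (λ x → f x * residual x) ≡ 0ℚ → ∀ x → residual x ≡ 0ℚ
    f*residual≡0⇒residual≡0 eq x = trans (sym (∑S-P residual x)) (∑S.J-0 vanish)
      where
      vanish : ∀ S → P S residual x ≡ 0ℚ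
      vanish S with d , _ , scale ← P-residual-scale S = p*p≡0⇒p≡0 (P S residual x) (begin
        P S residual x * P S residual x    ≡⟨ cong (_* P S residual x) (scale x) ⟩
        d * P S f x * P S residual x       ≡⟨ *-assoc d (P S f x) (P S residual x) ⟩
        d * (P S f x * P S residual x)     ≡⟨ cong (d *_) product≡0 ⟩
        d * 0ℚ                             ≡⟨ *-zeroʳ d ⟩
        0ℚ                                 ∎)
        where
        open ≡-Reasoning
        product≡0 : P S f x * P S residual x ≡ 0ℚ
        product≡0 = ∑Vℚ.definite (P-f*P-residual≥0 S)
          (∑S.definite (λ S → ∑Vℚ.nonNeg (P-f*P-residual≥0 S)) (trans (parseval f residual) eq) S) x

-- Positivity of Q and of the degree.

lcms>0 : ∀ {n} (qs : Vec ℕ n) → (∀ i → 0 ℕ.< lookup qs i) → 0 ℕ.< lcms qs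
lcms>0 []       _    = s≤s z≤n
lcms>0 (q ∷ qs) qs>0 = ℕ.n≢0⇒n>0 λ lcm≡0 →
  [ (λ q≡0 → ℕ.<⇒≢ (qs>0 zero) (sym q≡0))
  , (λ lcms≡0 → ℕ.<⇒≢ (lcms>0 qs (λ i → qs>0 (suc i))) (sym lcms≡0)) ]′
  (ℕ.m*n≡0⇒m≡0∨n≡0 q (trans (sym (ℕ.gcd*lcm q (lcms qs)))
    (trans (cong (ℕ.gcd q (lcms qs) ℕ.*_) lcm≡0) (ℕ.*-zeroʳ (ℕ.gcd q (lcms qs))))))

inv<1 : ∀ {q} → 2 ℕ.≤ q → inv q < 1ℚ
inv<1 {suc (suc m)} _ = subst (_< 1ℚ) (sym (normalize-coprime (Coprimality.1-coprimeTo (suc (suc m)))))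
  (*<* (ℤ.+<+ (s≤s (s≤s z≤n))))
inv<1 {suc zero} (s≤s ())

-- The degree is Q times the sum of the 1 - 1/q_i, each positive. Were the sum not positive, it
-- would be 0 and its first term would vanish.
degree>0 : ∀ {n} .{{_ : ℕ.NonZero n}} (qs : Vec ℕ n) {Q} → (∀ i → 2 ℕ.≤ lookup qs i) → 0ℚ < Q →
           0ℚ < degree Q qs
degree>0 {suc n} qs {Q} qs≥2 0<Q = *-pos 0<Q (≰⇒> λ ≤0 →
  <⇒≢ (1-inv>0 zero) (sym (∑ℚ.definite (λ i → <⇒≤ (1-inv>0 i)) (≤-antisym (subst (_≤ 0ℚ) (sym ∑≡) ≤0)
    (∑ℚ.nonNeg (λ i → <⇒≤ (1-inv>0 i)))) zero)))
  where
  1-inv>0 : ∀ i → 0ℚ < 1ℚ - inv (lookup qs i)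
  1-inv>0 i = subst (_< 1ℚ - inv (lookup qs i)) (+-inverseʳ (inv (lookup qs i)))
    (+-monoˡ-< (- inv (lookup qs i)) (inv<1 (qs≥2 i)))
  ∑≡ : ∑ℚ (λ i → 1ℚ - inv (lookup qs i)) ≡ fromℕ (suc n) - ∑ℚ (λ i → inv (lookup qs i))
  ∑≡ = trans (∑ℚ.J-minus (λ _ → 1ℚ) (λ i → inv (lookup qs i)))
    (cong (_- ∑ℚ (λ i → inv (lookup qs i)))
      (trans (∑ℚ-const (suc n) 1ℚ) (*-identityʳ (fromℕ (suc n)))))

-- The energy identity and the lower bound.

module Bound {n : ℕ} .{{_ : ℕ.NonZero n}} (qs : Vec ℕ n) (qs≥2 : ∀ i → 2 ℕ.≤ lookup qs i) (t : ℕ)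
  (k c bound : ℚ)
  (k≡ : k ≡ degree (fromℕ (lcms qs)) qs)
  (c≡ : c ≡ fromℕ (suc t) * fromℕ (lcms qs) - k)
  -- The bound with denominators cleared. Together with `k≡` and `c≡` it keeps the harmonic mean out
  -- of the argument; `c` stands for -θ_{t+1}.
  (bound≡ : fromℕ (suc t) * fromℕ (lcms qs) * bound ≡ fromℕ (∏ (lookup qs)) * c) where

  private
    Q T V m : ℚ
    Q = fromℕ (lcms qs)
    T = fromℕ (suc t)
    V = fromℕ (∏ (lookup qs))
    m = invs qs

    default : ∀ i → Fin (lookup qs i)
    default i = fromℕ< (ℕ.<⇒≤ (qs≥2 i))

    V*m≡1 : V * m ≡ 1ℚ
    V*m≡1 = ∏*invs qs default

    Q>0 : 0ℚ < Q
    Q>0 = fromℕ-mono-< {0} (lcms>0 qs (λ i → ℕ.<⇒≤ (qs≥2 i)))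

    T>0 : 0ℚ < T
    T>0 = fromℕ-mono-< {0} {suc t} (s≤s z≤n)

    TQ>0 : 0ℚ < T * Q
    TQ>0 = *-pos T>0 Q>0

  -- The premise says (t+1)QN/|V| = c. This is linear in `N` with nonzero coefficient, and `bound`
  -- solves it too.
  bound-unique : ∀ {N} → Q * (T * (m * N)) ≡ c → N ≡ bound
  bound-unique {N} eq =
    p-q≡0⇒p≡q (*-cancelˡ-0 (T * Q) (λ TQ≡0 → <⇒≢ TQ>0 (sym TQ≡0)) difference≡0)
    where
    open ≡-Reasoning
    p-q≡0⇒p≡q : ∀ {p q} → p - q ≡ 0ℚ → p ≡ q
    p-q≡0⇒p≡q {p} {q} eq = trans (cancel p q) (trans (cong (_+ q) eq) (+-identityˡ q))
      where
      cancel : ∀ p q → p ≡ (p - q) + q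
      cancel = solve-∀ ring
    regroup : ∀ V m T Q N → V * m * (T * Q * N) ≡ V * (Q * (T * (m * N)))
    regroup = solve-∀ ring
    difference≡0 : T * Q * (N - bound) ≡ 0ℚ
    difference≡0 = begin
      T * Q * (N - bound)                       ≡⟨ expand (T * Q) N bound ⟩
      1ℚ * (T * Q * N) - T * Q * bound          ≡⟨ cong₂ (λ u v → u * (T * Q * N) - v) (sym V*m≡1) bound≡ ⟩
      V * m * (T * Q * N) - V * c               ≡⟨ cong (_- V * c) (regroup V m T Q N) ⟩
      V * (Q * (T * (m * N))) - V * c           ≡⟨ cong (λ r → V * r - V * c) eq ⟩
      V * c - V * c                             ≡⟨ +-inverseʳ (V * c) ⟩
      0ℚ                                        ∎
      where
      expand : ∀ x y z → x * (y - z) ≡ 1ℚ * (x * y) - x * z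
      expand = solve-∀ ring

  module _ (C : Multiset qs) where

    private
      f : Vertex qs → ℚ
      f = ⟦ C ⟧
      N H : ℚ
      N = ∑Vℚ f
      -- `H` is ⟨f, f - 1⟩ and measures repeated elements; `G` below is ⟨f, A f⟩ and measures edges
      -- within the code.
      H = ∑Vℚ (λ x → f x * f x - f x)
      A : Vertex qs → ℚ
      A x = ∑Vℚ (λ y → fromℕ (edges qs qs≥2 x y) * f y)
      G = ∑Vℚ (λ x → f x * A x)

    open Residual t f

    private
      D = ∑Vℚ (λ x → f x * residual x)

      A≡ : ∀ x → A x ≡ k * f x - Q * L f x
      A≡ x = trans (∑Vℚ-edges qs qs≥2 x f) (cong (λ r → r * f x - Q * L f x) (sym k≡))

      f*A≥0 : ∀ x → 0ℚ ≤ f x * A x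
      f*A≥0 x = *-nonNeg (fromℕ≥0 (C x))
        (∑Vℚ.nonNeg (λ y → *-nonNeg (fromℕ≥0 (edges qs qs≥2 x y)) (fromℕ≥0 (C y))))

      -- Multiplicities are natural numbers, and m ≤ m² for these.
      f²-f≥0 : ∀ x → 0ℚ ≤ f x * f x - f x
      f²-f≥0 x = subst₂ _≤_ (+-inverseʳ (f x)) (cong (_- f x) (fromℕ-* (C x) (C x)))
        (+-monoˡ-≤ (- f x) (fromℕ-mono-≤ (m≤m*m (C x))))
        where
        m≤m*m : ∀ m → m ℕ.≤ m ℕ.* m
        m≤m*m zero      = z≤n
        m≤m*m m@(suc _) = ℕ.m≤m*n m m

    -- The identity holds pointwise: after substituting `A≡`, the terms in `L f` and the quadratic
    -- terms cancel.
    energy : Q * (T * (m * N)) * N ≡ c * N + (Q * D + (c * H + G))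
    energy = begin
      Q * (T * (m * N)) * N
        ≡⟨ ∑Vℚ.J-* (Q * (T * (m * N))) f ⟨
      ∑Vℚ (λ x → Q * (T * (m * N)) * f x)
        ≡⟨ ∑Vℚ.J-cong pointwise ⟩
      ∑Vℚ (λ x → c * f x + (Q * (f x * residual x) + (c * (f x * f x - f x) + f x * A x)))
        ≡⟨ ∑Vℚ.J-+ (λ x → c * f x) _ ⟩
      ∑Vℚ (λ x → c * f x) + ∑Vℚ (λ x → Q * (f x * residual x) + (c * (f x * f x - f x) + f x * A x))
        ≡⟨ cong₂ _+_ (∑Vℚ.J-* c f) (∑Vℚ.J-+ (λ x → Q * (f x * residual x)) _) ⟩
      c * N + (∑Vℚ (λ x → Q * (f x * residual x)) + ∑Vℚ (λ x → c * (f x * f x - f x) + f x * A x))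
        ≡⟨ cong (_+_ (c * N)) (cong₂ _+_ (∑Vℚ.J-* Q (λ x → f x * residual x))
             (trans (∑Vℚ.J-+ (λ x → c * (f x * f x - f x)) (λ x → f x * A x))
               (cong (_+ G) (∑Vℚ.J-* c (λ x → f x * f x - f x))))) ⟩
      c * N + (Q * D + (c * H + G)) ∎
      where
      open ≡-Reasoning
      identity : ∀ Q T k u l μ → Q * (T * μ) * u ≡
        (T * Q - k) * u + (Q * (u * ((l - T * u) + T * μ)) +
          ((T * Q - k) * (u * u - u) + u * (k * u - Q * l)))
      identity = solve-∀ ring
      pointwise : ∀ x → Q * (T * (m * N)) * f x ≡
        c * f x + (Q * (f x * residual x) + (c * (f x * f x - f x) + f x * A x))
      pointwise x = trans (identity Q T k (f x) (L f x) (m * N))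
        (cong₂ (λ r s → r * f x + (Q * (f x * residual x) + (r * (f x * f x - f x) + f x * s)))
          (sym c≡) (sym (A≡ x)))

    module _ (none : NoComponents t f) (0<N : 0ℚ < N) where

      private
        QD≥0 : 0ℚ ≤ Q * D
        QD≥0 = *-nonNeg (<⇒≤ Q>0) (f*residual≥0 none)

        G≥0 : 0ℚ ≤ G
        G≥0 = ∑Vℚ.nonNeg f*A≥0

        H≥0 : 0ℚ ≤ H
        H≥0 = ∑Vℚ.nonNeg f²-f≥0

      -- If `c ≤ 0`, the bound is at most 0. Otherwise dropping the nonnegative terms from `energy`
      -- and dividing by `N > 0` gives c ≤ (t+1)QN/|V|.
      bound-≤ : bound ≤ N
      bound-≤ with ≤-total 0ℚ c
      ... | inj₂ c≤0 = ≤-trans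
        (*-cancelˡ-≤-pos (T * Q) {{positive TQ>0}} (subst₂ _≤_ (sym bound≡)
          (trans (*-zeroʳ V) (sym (*-zeroʳ (T * Q))))
          (*-monoˡ-≤-nonNeg V {{nonNegative (fromℕ≥0 (∏ (lookup qs)))}} c≤0)))
        (<⇒≤ 0<N)
      ... | inj₁ 0≤c = *-cancelˡ-≤-pos (T * Q) {{positive TQ>0}} (subst₂ _≤_ (sym bound≡) V*QTmN≡
        (*-monoˡ-≤-nonNeg V {{nonNegative (fromℕ≥0 (∏ (lookup qs)))}} c≤QTmN))
        where
        regroup : ∀ V Q T m N → V * (Q * (T * (m * N))) ≡ V * m * (T * Q * N)
        regroup = solve-∀ ring
        V*QTmN≡ : V * (Q * (T * (m * N))) ≡ T * Q * N
        V*QTmN≡ = trans (regroup V Q T m N) (trans (cong (_* (T * Q * N)) V*m≡1) (*-identityˡ (T * Q * N)))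
        c≤QTmN : c ≤ Q * (T * (m * N))
        c≤QTmN = *-cancelʳ-≤-pos N {{positive 0<N}} (subst₂ _≤_ (+-identityʳ (c * N)) (sym energy)
          (+-monoʳ-≤ (c * N) (+-nonNeg QD≥0 (+-nonNeg (*-nonNeg 0≤c H≥0) G≥0))))

      -- The equality case.

      module _ (N≡bound : N ≡ bound) where

        mean≡ : Q * (T * (m * N)) ≡ c
        mean≡ = begin
          Q * (T * (m * N))          ≡⟨ regroup Q T m N ⟩
          m * (T * Q * N)            ≡⟨ cong (λ r → m * (T * Q * r)) N≡bound ⟩
          m * (T * Q * bound)        ≡⟨ cong (m *_) bound≡ ⟩
          m * (V * c)                ≡⟨ regroup′ m V c ⟩
          V * m * c                  ≡⟨ cong (_* c) V*m≡1 ⟩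
          1ℚ * c                     ≡⟨ *-identityˡ c ⟩
          c                          ∎
          where
          open ≡-Reasoning
          regroup : ∀ Q T m N → Q * (T * (m * N)) ≡ m * (T * Q * N)
          regroup = solve-∀ ring
          regroup′ : ∀ m V c → m * (V * c) ≡ V * m * c
          regroup′ = solve-∀ ring

        -- The bound equals the positive `N`, and `bound≡` passes its sign on to `c`.
        c>0 : 0ℚ < c
        c>0 = *-cancelˡ-<-nonNeg V {{nonNegative (fromℕ≥0 (∏ (lookup qs)))}}
          (subst₂ _<_ (sym (*-zeroʳ V)) (trans (cong (T * Q *_) N≡bound) bound≡) (*-pos TQ>0 0<N))

        private
          -- By `mean≡` the left side of `energy` is already `c * N`, which leaves 0 for the three
          -- nonnegative terms together.
          excess≡0 : Q * D + (c * H + G) ≡ 0ℚ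
          excess≡0 = begin
            Q * D + (c * H + G)                     ≡⟨ cancel (c * N) (Q * D + (c * H + G)) ⟩
            c * N + (Q * D + (c * H + G)) - c * N   ≡⟨ cong (_- c * N) energy ⟨
            Q * (T * (m * N)) * N - c * N           ≡⟨ cong (λ r → r * N - c * N) mean≡ ⟩
            c * N - c * N                           ≡⟨ +-inverseʳ (c * N) ⟩
            0ℚ                                      ∎
            where
            open ≡-Reasoning
            cancel : ∀ x y → y ≡ x + y - x
            cancel = solve-∀ ring

          cH≥0 : 0ℚ ≤ c * H
          cH≥0 = *-nonNeg (<⇒≤ c>0) H≥0

          QD≡0×cH+G≡0 : Q * D ≡ 0ℚ × c * H + G ≡ 0ℚ
          QD≡0×cH+G≡0 = +-zero-summands QD≥0 (+-nonNeg cH≥0 G≥0) excess≡0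

          cH≡0×G≡0 : c * H ≡ 0ℚ × G ≡ 0ℚ
          cH≡0×G≡0 = +-zero-summands cH≥0 G≥0 (proj₂ QD≡0×cH+G≡0)

        residual≡0 : ∀ x → residual x ≡ 0ℚ
        residual≡0 = f*residual≡0⇒residual≡0 none
          (*-cancelˡ-0 Q (λ Q≡0 → <⇒≢ Q>0 (sym Q≡0)) (proj₁ QD≡0×cH+G≡0))

        f*A≡0 : ∀ x → f x * A x ≡ 0ℚ
        f*A≡0 = ∑Vℚ.definite f*A≥0 (proj₂ cH≡0×G≡0)

        simple : Simple C
        simple x = m*m≡m⇒m≤1 (C x) (fromℕ-injective (begin
          fromℕ (C x ℕ.* C x)        ≡⟨ fromℕ-* (C x) (C x) ⟩
          f x * f x                  ≡⟨ cancel (f x * f x) (f x) ⟩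
          (f x * f x - f x) + f x    ≡⟨ cong (_+ f x) (∑Vℚ.definite f²-f≥0 H≡0 x) ⟩
          0ℚ + f x                   ≡⟨ +-identityˡ (f x) ⟩
          f x                        ∎))
          where
          open ≡-Reasoning
          cancel : ∀ x y → x ≡ (x - y) + y
          cancel = solve-∀ ring
          H≡0 : H ≡ 0ℚ
          H≡0 = *-cancelˡ-0 c (λ c≡0 → <⇒≢ c>0 (sym c≡0)) (proj₁ cH≡0×G≡0)
          m*m≡m⇒m≤1 : ∀ m → m ℕ.* m ≡ m → m ℕ.≤ 1
          m*m≡m⇒m≤1 zero      _  = z≤n
          m*m≡m⇒m≤1 m@(suc _) eq = ℕ.≤-reflexive (ℕ.*-cancelˡ-≡ m 1 m (trans eq (sym (ℕ.*-identityʳ m))))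

        isCRCode : IsCRCode qs qs≥2 k c (Support? C)
        isCRCode = record
          { b>0     = subst (0ℚ <_) (sym k≡) (degree>0 qs qs≥2 Q>0)
          ; c>0     = c>0
          ; inside  = inside-k
          ; outside = outside-c
          }
          where
          open ≡-Reasoning
          -- For a codeword `f x` is nonzero, so `f*A≡0` leaves it no neighbour in the code and all
          -- `k` edges go out.
          inside-k : ∀ x → Support C x → fromℕ (edgesTo qs qs≥2 (∁? (Support? C)) x) ≡ k
          inside-k x 0<Cx = begin
            fromℕ (edgesTo qs qs≥2 (∁? (Support? C)) x)
              ≡⟨ edgesTo-∁Support qs qs≥2 simple x ⟩
            degree Q qs * (1ℚ - f x) - Q * L (λ y → 1ℚ - f y) x
              ≡⟨ cong₂ (λ r s → r * (1ℚ - f x) - Q * s) (sym k≡)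
                   (trans (J-minus (L-linear x) (λ _ → 1ℚ) f) (cong (_- L f x) (L-const 1ℚ x))) ⟩
            k * (1ℚ - f x) - Q * (0ℚ - L f x)
              ≡⟨ rearrange k (f x) Q (L f x) ⟩
            k - (k * f x - Q * L f x)
              ≡⟨ cong (λ r → k - r) (trans (sym (A≡ x)) A≡0) ⟩
            k - 0ℚ
              ≡⟨ +-identityʳ k ⟩
            k ∎
            where
            rearrange : ∀ k u Q l → k * (1ℚ - u) - Q * (0ℚ - l) ≡ k - (k * u - Q * l)
            rearrange = solve-∀ ring
            fx≢0 : f x ≢ 0ℚ
            fx≢0 fx≡0 = ℕ.<⇒≢ 0<Cx (sym (fromℕ-injective {C x} {0} fx≡0))
            A≡0 : A x ≡ 0ℚ
            A≡0 = *-cancelˡ-0 (f x) fx≢0 (f*A≡0 x)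
          -- Off the code `f x = 0`, so a zero residual gives Q L f = -c, and the number of edges
          -- into the code is -Q L f.
          outside-c : ∀ x → ¬ Support C x → fromℕ (edgesTo qs qs≥2 (Support? C) x) ≡ c
          outside-c x Cx≯0 = begin
            fromℕ (edgesTo qs qs≥2 (Support? C) x)
              ≡⟨ edgesTo-Support qs qs≥2 simple x ⟩
            degree Q qs * f x - Q * L f x
              ≡⟨ rearrange (degree Q qs) (f x) Q (L f x) T (m * N) ⟩
            (degree Q qs - Q * T) * f x + (Q * (T * (m * N)) - Q * residual x)
              ≡⟨ cong₂ (λ u r → (degree Q qs - Q * T) * u + (Q * (T * (m * N)) - Q * r)) fx≡0 (residual≡0 x) ⟩
            (degree Q qs - Q * T) * 0ℚ + (Q * (T * (m * N)) - Q * 0ℚ)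
              ≡⟨ zeros (degree Q qs - Q * T) (Q * (T * (m * N))) Q ⟩
            Q * (T * (m * N))
              ≡⟨ mean≡ ⟩
            c ∎
            where
            rearrange : ∀ k u Q l T μ → k * u - Q * l ≡ (k - Q * T) * u + (Q * (T * μ) - Q * ((l - T * u) + T * μ))
            rearrange = solve-∀ ring
            zeros : ∀ x y z → x * 0ℚ + (y - z * 0ℚ) ≡ y
            zeros = solve-∀ ring
            fx≡0 : f x ≡ 0ℚ
            fx≡0 = cong fromℕ (ℕ.n≤0⇒n≡0 (ℕ.≮⇒≥ Cx≯0))

    -- From a completely regular code back to a tight array.

    module _ (simple : Simple C) (cr : IsCRCode qs qs≥2 k c (Support? C)) where
      -- Every edge at a codeword leaves the code, so Q L f = k there, and Q L f = -c elsewhere. One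
      -- formula covers both because k + c = (t+1)Q.
      Q*L≡ : ∀ x → Q * L f x ≡ T * Q * f x - c
      Q*L≡ x = by-value (C x) refl (simple x)
        where
        open ≡-Reasoning
        by-value : ∀ v → C x ≡ v → v ℕ.≤ 1 → Q * L f x ≡ T * Q * f x - c
        by-value zero Cx≡0 _ = begin
          Q * L f x                                  ≡⟨ rearrange Q (L f x) k ⟩
          k * 0ℚ - (k * 0ℚ - Q * L f x)              ≡⟨ cong (λ r → k * 0ℚ - r) edges≡c ⟩
          k * 0ℚ - c                                 ≡⟨ cong (_- c) (trans (*-zeroʳ k) (sym (*-zeroʳ (T * Q)))) ⟩
          T * Q * 0ℚ - c                             ≡⟨ cong (λ r → T * Q * r - c) fx≡0 ⟨
          T * Q * f x - c                            ∎
          where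
          rearrange : ∀ Q l k → Q * l ≡ k * 0ℚ - (k * 0ℚ - Q * l)
          rearrange = solve-∀ ring
          fx≡0 : f x ≡ 0ℚ
          fx≡0 = cong fromℕ Cx≡0
          edges≡c : k * 0ℚ - Q * L f x ≡ c
          edges≡c = trans (cong₂ (λ r u → r * u - Q * L f x) k≡ (sym fx≡0))
            (trans (sym (edgesTo-Support qs qs≥2 simple x))
              (IsCRCode.outside cr x (λ 0<Cx → ℕ.<⇒≢ 0<Cx (sym Cx≡0))))
        by-value (suc zero) Cx≡1 _ = begin
          Q * L f x                                                ≡⟨ rearrange Q (L f x) k ⟩
          k * (1ℚ - 1ℚ) - Q * (0ℚ - L f x)                         ≡⟨ edges≡k ⟩
          k                                                        ≡⟨ cancel T Q k ⟩
          T * Q * 1ℚ - (T * Q - k)                                 ≡⟨ cong₂ (λ u r → T * Q * u - r) (sym fx≡1) (sym c≡) ⟩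
          T * Q * f x - c                                          ∎
          where
          rearrange : ∀ Q l k → Q * l ≡ k * (1ℚ - 1ℚ) - Q * (0ℚ - l)
          rearrange = solve-∀ ring
          cancel : ∀ T Q k → k ≡ T * Q * 1ℚ - (T * Q - k)
          cancel = solve-∀ ring
          fx≡1 : f x ≡ 1ℚ
          fx≡1 = cong fromℕ Cx≡1
          edges≡k : k * (1ℚ - 1ℚ) - Q * (0ℚ - L f x) ≡ k
          edges≡k = trans (cong₂ (λ r u → r * (1ℚ - u) - Q * (0ℚ - L f x)) k≡ (sym fx≡1))
            (trans (cong (λ r → degree Q qs * (1ℚ - f x) - Q * r)
                (sym (trans (J-minus (L-linear x) (λ _ → 1ℚ) f) (cong (_- L f x) (L-const 1ℚ x)))))
              (trans (sym (edgesTo-∁Support qs qs≥2 simple x))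
                (IsCRCode.inside cr x (subst (0 ℕ.<_) (sym Cx≡1) (s≤s z≤n)))))
        by-value (suc (suc _)) _ (s≤s ())

      P-eigen : ∀ S x → Q * (fromℕ ∣ S ∣ * P S f x) ≡ T * Q * P S f x - P S (λ _ → c) x
      P-eigen S x = begin
        Q * (fromℕ ∣ S ∣ * P S f x)                  ≡⟨ cong (Q *_) (P-L S f x) ⟨
        Q * P S (L f) x                              ≡⟨ J-* lin Q (L f) ⟨
        P S (λ y → Q * L f y) x                      ≡⟨ J-cong lin Q*L≡ ⟩
        P S (λ y → T * Q * f y - c) x                ≡⟨ J-minus lin (λ y → T * Q * f y) (λ _ → c) ⟩
        P S (λ y → T * Q * f y) x - P S (λ _ → c) x  ≡⟨ cong (_- P S (λ _ → c) x) (J-* lin (T * Q) f) ⟩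
        T * Q * P S f x - P S (λ _ → c) x            ∎
        where
        open ≡-Reasoning
        lin = P-linear S x

      -- For nonempty `S` the constant in `P-eigen` disappears and leaves Q(t+1-|S|) P_S f = 0,
      -- where |S| ≤ t makes the coefficient positive.
      noComponents : NoComponents t f
      noComponents S 0<∣S∣ ∣S∣≤t x = *-cancelˡ-0 (Q * (T - fromℕ ∣ S ∣)) scale≢0 (begin
        Q * (T - fromℕ ∣ S ∣) * P S f x
          ≡⟨ rearrange Q T (fromℕ ∣ S ∣) (P S f x) ⟩
        T * Q * P S f x - 0ℚ - Q * (fromℕ ∣ S ∣ * P S f x)
          ≡⟨ cong (λ r → T * Q * P S f x - r - Q * (fromℕ ∣ S ∣ * P S f x)) (P-const S 0<∣S∣ c x) ⟨
        T * Q * P S f x - P S (λ _ → c) x - Q * (fromℕ ∣ S ∣ * P S f x)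
          ≡⟨ cong (_- Q * (fromℕ ∣ S ∣ * P S f x)) (P-eigen S x) ⟨
        Q * (fromℕ ∣ S ∣ * P S f x) - Q * (fromℕ ∣ S ∣ * P S f x)
          ≡⟨ +-inverseʳ (Q * (fromℕ ∣ S ∣ * P S f x)) ⟩
        0ℚ ∎)
        where
        open ≡-Reasoning
        rearrange : ∀ Q T s p → Q * (T - s) * p ≡ T * Q * p - 0ℚ - Q * (s * p)
        rearrange = solve-∀ ring
        T-∣S∣>0 : 0ℚ < T - fromℕ ∣ S ∣
        T-∣S∣>0 = subst (_< T - fromℕ ∣ S ∣) (+-inverseʳ (fromℕ ∣ S ∣))
          (+-monoˡ-< (- fromℕ ∣ S ∣) (fromℕ-mono-< (s≤s ∣S∣≤t)))
        scale≢0 : Q * (T - fromℕ ∣ S ∣) ≢ 0ℚ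
        scale≢0 eq = <⇒≢ (*-pos Q>0 T-∣S∣>0) (sym eq)

      -- This is `P-eigen` at `⊥`, where `L` has eigenvalue 0 and the component of `f` is its mean;
      -- `x` is an arbitrary vertex.
      Q*T*mean≡c : Q * (T * (m * N)) ≡ c
      Q*T*mean≡c = begin
        Q * (T * (m * N))
          ≡⟨ cong (λ r → Q * (T * r)) (P-⊥ f x) ⟨
        Q * (T * P ⊥ f x)
          ≡⟨ rearrange Q T (P ⊥ f x) c ⟩
        (T * Q * P ⊥ f x - c) + c
          ≡⟨ cong (λ r → (T * Q * P ⊥ f x - r) + c) (P-⊥-const c x) ⟨
        (T * Q * P ⊥ f x - P ⊥ (λ _ → c) x) + c
          ≡⟨ cong (_+ c) (P-eigen ⊥ x) ⟨
        Q * (fromℕ ∣ ⊥ {n} ∣ * P ⊥ f x) + c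
          ≡⟨ cong (λ s → Q * (fromℕ s * P ⊥ f x) + c) (∣⊥∣≡0 n) ⟩
        Q * (0ℚ * P ⊥ f x) + c
          ≡⟨ zeros Q (P ⊥ f x) c ⟩
        c ∎
        where
        open ≡-Reasoning
        x : Vertex qs
        x = lookup⁻ default
        rearrange : ∀ Q T p c → Q * (T * p) ≡ (T * Q * p - c) + c
        rearrange = solve-∀ ring
        zeros : ∀ Q p c → Q * (0ℚ * p) + c ≡ c
        zeros = solve-∀ ring

      -- An empty code has mean 0, which would force `c = 0`.
      card>0 : 0 ℕ.< card C
      card>0 = ℕ.n≢0⇒n>0 λ card≡0 → <⇒≢ (IsCRCode.c>0 cr) (sym (begin
        c                       ≡⟨ Q*T*mean≡c ⟨
        Q * (T * (m * N))       ≡⟨ cong (λ r → Q * (T * (m * r))) (trans (sym (fromℕ-∑V C)) (cong fromℕ card≡0)) ⟩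
        Q * (T * (m * 0ℚ))      ≡⟨ zeros Q T m ⟩
        0ℚ                      ∎))
        where
        open ≡-Reasoning
        zeros : ∀ Q T m → Q * (T * (m * 0ℚ)) ≡ 0ℚ
        zeros = solve-∀ ring

      CR⇒OA : IsOA (card C) t C
      CR⇒OA = NoComponents⇒OA default card>0 noComponents

      CR⇒bound : fromℕ (card C) ≡ bound
      CR⇒bound = trans (fromℕ-∑V C) (bound-unique Q*T*mean≡c)

-- Translation of the stated parameters and conclusion.

1/≡inv : ∀ m .{{_ : NonZero m}} → + 1 / m ≡ inv m
1/≡inv (suc m) = refl

*-1/ : ∀ m .{{_ : NonZero m}} → fromℕ m * (+ 1 / m) ≡ 1ℚ
*-1/ (suc m) = *-inv m

/≡*inv : ∀ m d → + m / suc d ≡ fromℕ m * inv (suc d)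
/≡*inv m d = sym (trans
  (cong₂ _*_ (fromℕ≡mkℚ m) (normalize-coprime (Coprimality.1-coprimeTo (suc d))))
  (/-cong (ℤ.*-identityʳ (+ m)) (ℕ.*-identityˡ (suc d))))

theorem9 : (n : ℕ) .{{_ : NonZero n}} (qs : Vec ℕ n) (qs≥2 : (i : Fin n) → 2 ≤ℕ lookup qs i)
           (t : ℕ) → t ≤ℕ n →
           (q : ℚ) .{{_ : NonZeroℚ q}} → IsHarmonicMean qs qs≥2 q →
           let bound = fromℕ (∏ (lookup qs)) * (1ℚ - (1ℚ - 1/ q) * (+ n / suc t))
               Q     = fromℕ (lcms qs)
               k     = Q * fromℕ n * (1ℚ - 1/ q)
               θ     = k - fromℕ (suc t) * Q
           in ((N : ℕ) (C : Multiset qs) → IsOA N t C → fromℕ N ≥ bound)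
            × ((C : Multiset qs) →
               (IsOA (card C) t C × fromℕ (card C) ≡ bound)
                 ⇔ (Simple C × IsCRCode qs qs≥2 k (- θ) (Support? C)))
theorem9 n qs qs≥2 t t≤n q harmonic = lower-bound , λ C → mk⇔ (OA⇒CR C) (CR⇒OA C)
  where
  V Q T p k c bound : ℚ
  V     = fromℕ (∏ (lookup qs))
  Q     = fromℕ (lcms qs)
  T     = fromℕ (suc t)
  p     = 1/ q
  k     = Q * fromℕ n * (1ℚ - p)
  c     = - (k - T * Q)
  bound = V * (1ℚ - (1ℚ - p) * (+ n / suc t))

  σ : ℚ
  σ = ∑ℚ (λ i → inv (lookup qs i))

  -- The harmonic mean enters here: n/q is the sum `σ` of the reciprocals.
  k≡ : k ≡ degree Q qs
  k≡ = begin
    Q * fromℕ n * (1ℚ - p)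
      ≡⟨ cong (λ r → Q * fromℕ n * (1ℚ - r)) (trans harmonic (cong (+ 1 / n *_)
           (∑ℚ.J-cong (λ i → 1/≡inv (lookup qs i) {{ℕ.>-nonZero (ℕ.<⇒≤ (qs≥2 i))}})))) ⟩
    Q * fromℕ n * (1ℚ - + 1 / n * σ)
      ≡⟨ expand Q (fromℕ n) (+ 1 / n) σ ⟩
    Q * (fromℕ n - fromℕ n * (+ 1 / n) * σ)
      ≡⟨ cong (λ r → Q * (fromℕ n - r * σ)) (*-1/ n) ⟩
    Q * (fromℕ n - 1ℚ * σ)
      ≡⟨ cong (λ r → Q * (fromℕ n - r)) (*-identityˡ σ) ⟩
    degree Q qs ∎
    where
    open ≡-Reasoning
    expand : ∀ Q n i σ → Q * n * (1ℚ - i * σ) ≡ Q * (n - n * i * σ)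
    expand = solve-∀ ring

  c≡ : c ≡ T * Q - k
  c≡ = negate k (T * Q)
    where
    negate : ∀ x y → - (x - y) ≡ y - x
    negate = solve-∀ ring

  -- Multiplying by t+1 cancels the denominator of n/(t+1), and what remains of the subtracted term
  -- is `k`.
  bound≡ : T * Q * bound ≡ V * c
  bound≡ = begin
    T * Q * (V * (1ℚ - (1ℚ - p) * (+ n / suc t)))
      ≡⟨ cong (λ r → T * Q * (V * (1ℚ - (1ℚ - p) * r))) (/≡*inv n t) ⟩
    T * Q * (V * (1ℚ - (1ℚ - p) * (fromℕ n * inv (suc t))))
      ≡⟨ expand T Q V p (fromℕ n) (inv (suc t)) ⟩
    V * (T * Q - T * inv (suc t) * (Q * fromℕ n * (1ℚ - p)))
      ≡⟨ cong (λ r → V * (T * Q - r * k)) (*-inv t) ⟩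
    V * (T * Q - 1ℚ * k)
      ≡⟨ cong (λ r → V * (T * Q - r)) (*-identityˡ k) ⟩
    V * (T * Q - k)
      ≡⟨ cong (V *_) c≡ ⟨
    V * c ∎
    where
    open ≡-Reasoning
    expand : ∀ T Q V p n i → T * Q * (V * (1ℚ - (1ℚ - p) * (n * i))) ≡
                             V * (T * Q - T * i * (Q * n * (1ℚ - p)))
    expand = solve-∀ ring

  module B = Bound qs qs≥2 t k c bound k≡ c≡ bound≡

  ∑⟦C⟧>0 : ∀ {N C} → IsOA N t C → 0ℚ < ∑Vℚ ⟦ C ⟧
  ∑⟦C⟧>0 {C = C} oa = subst (0ℚ <_) (fromℕ-∑V C) (fromℕ-mono-< (IsOA.nonempty oa))

  lower-bound : (N : ℕ) (C : Multiset qs) → IsOA N t C → bound ≤ fromℕ N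
  lower-bound N C oa = subst (bound ≤_)
    (trans (sym (fromℕ-∑V C)) (cong fromℕ (IsOA.size oa)))
    (B.bound-≤ C (OA⇒NoComponents t≤n oa) (∑⟦C⟧>0 oa))

  OA⇒CR : ∀ C → IsOA (card C) t C × fromℕ (card C) ≡ bound →
          Simple C × IsCRCode qs qs≥2 k c (Support? C)
  OA⇒CR C (oa , tight) = B.simple C none (∑⟦C⟧>0 oa) tight′ , B.isCRCode C none (∑⟦C⟧>0 oa) tight′
    where
    none : NoComponents t ⟦ C ⟧
    none = OA⇒NoComponents t≤n oa
    tight′ : ∑Vℚ ⟦ C ⟧ ≡ bound
    tight′ = trans (sym (fromℕ-∑V C)) tight

  CR⇒OA : ∀ C → Simple C × IsCRCode qs qs≥2 k c (Support? C) →
          IsOA (card C) t C × fromℕ (card C) ≡ bound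
  CR⇒OA C (simple , cr) = B.CR⇒OA C simple cr , B.CR⇒bound C simple cr
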